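{- (i) For every $k \leq 4$, the class of $k$-connected planar graphs is not $T_3$-reconstructible. (ii) The class of 5-connected planar graphs is $T_3$-reconstructible. (iii) For $k \geq 6$ there is no $k$-connected planar graph.
   Context: Graphs are finite, simple, connected and labeled; two labeled graphs are identical iff they have the same vertex set and edge set. $T_3(G)$ is the set of 3-element subsets of $V(G)$ inducing a connected subgraph of $G$. A class $\mathcal{C}$ of graphs is $T_3$-reconstructible if any two distinct labeled graphs $G_1 \neq G_2$ in $\mathcal{C}$ satisfy $T_3(G_1) \neq T_3(G_2)$. -}

module Defs where

open import Data.Nat using (ℕ; zero; suc; _+_; _<_; _≤_)
open import Data.Bool using (Bool; true; false; if_then_else_)
open import Data.Fin using (Fin)
open import Data.Fin.Properties using () renaming (_<?_ to _<ᶠ?_)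
open import Data.Fin.Subset using (Subset; _∈_; _⊆_; _─_; ∣_∣; Nonempty)
open import Data.List using (List; map)
open import Data.Nat.ListAction using (sum)
open import Data.List using () renaming (allFin to allFinL)
open import Data.Product using (Σ; _×_; _,_; ∃; ∃-syntax)
open import Data.Sum using (_⊎_)
open import Relation.Binary.PropositionalEquality using (_≡_; _≢_)
open import Relation.Nullary using (¬_; does)
open import Function.Bundles using (_⇔_)

-- Labeled graphs.  Labels are taken from a finite universe Fin N; a
-- graph has a vertex set V ⊆ Fin N and a simple (symmetric, loopless)
-- edge relation whose edges join vertices of V.

record Graph (N : ℕ) : Set where
  field
    V     : Subset N
    adj   : Fin N → Fin N → Bool
    sym   : ∀ u v → adj u v ≡ true → adj v u ≡ true
    loopless : ∀ v → adj v v ≡ false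
    inV   : ∀ u v → adj u v ≡ true → u ∈ V

open Graph public

Adj : ∀ {N} → Graph N → Fin N → Fin N → Set
Adj G u v = adj G u v ≡ true

Identical : ∀ {N} → Graph N → Graph N → Set
Identical G₁ G₂ = (V G₁ ≡ V G₂) × (∀ u v → adj G₁ u v ≡ adj G₂ u v)

data WalkIn {N} (G : Graph N) (S : Subset N) : Fin N → Fin N → Set where
  stop : ∀ {u} → u ∈ S → WalkIn G S u u
  step : ∀ {u w v} → u ∈ S → Adj G u w → WalkIn G S w v → WalkIn G S u v

ConnectedOn : ∀ {N} → Graph N → Subset N → Set
ConnectedOn G S = ∀ u v → u ∈ S → v ∈ S → WalkIn G S u v

Connected : ∀ {N} → Graph N → Set
Connected G = Nonempty (V G) × ConnectedOn G (V G)

-- k-connected (Diestel): more than k vertices, and G - X is connected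
-- for every vertex set X with |X| < k.
KConnected : ∀ {N} → ℕ → Graph N → Set
KConnected {N} k G =
  (k < ∣ V G ∣) ×
  (∀ (X : Subset N) → X ⊆ V G → ∣ X ∣ < k → ConnectedOn G (V G ─ X))

InT3 : ∀ {N} → Graph N → Subset N → Set
InT3 G S = (∣ S ∣ ≡ 3) × (S ⊆ V G) × ConnectedOn G S

SameT3 : ∀ {N} → Graph N → Graph N → Set
SameT3 {N} G₁ G₂ = ∀ (S : Subset N) → InT3 G₁ S ⇔ InT3 G₂ S

iter : ∀ {A : Set} → (A → A) → ℕ → A → A
iter f zero    x = x
iter f (suc j) x = f (iter f j x)

numEdges : ∀ {N} → Graph N → ℕ
numEdges {N} G =
  sum (map (λ u → sum (map (λ v →
    if does (u <ᶠ? v) then (if adj G u v then 1 else 0) else 0)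
    (allFinL N))) (allFinL N))

facePerm : ∀ {N} → (Fin N → Fin N → Fin N) → Fin N × Fin N → Fin N × Fin N
facePerm ρ (u , v) = (v , ρ v u)

-- A spherical (genus 0) combinatorial embedding of G:
--  * a rotation system ρ: for each vertex v, ρ v is a cyclic permutation
--    of the neighbourhood N(v);
--  * the face permutation on darts (u,v) is φ(u,v) = (v, ρ v u);
--  * faces are the orbits of φ; `face` labels darts by their orbit, with
--    F faces in total;
--  * Euler's formula |V| - |E| + F = 2 holds.
record SphericalEmbedding {N} (G : Graph N) : Set where
  field
    ρ      : Fin N → Fin N → Fin N
    ρ-adj  : ∀ v u → Adj G v u → Adj G v (ρ v u)
    ρ-inj  : ∀ v u w → Adj G v u → Adj G v w → ρ v u ≡ ρ v w → u ≡ w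
    ρ-cyc  : ∀ v u w → Adj G v u → Adj G v w → ∃[ j ] iter (ρ v) j u ≡ w
    F      : ℕ
    face   : Fin N → Fin N → Fin F
    face-surj  : ∀ (f : Fin F) → ∃[ u ] ∃[ v ] (Adj G u v × face u v ≡ f)
    face-orbit : ∀ u v u' v' → Adj G u v → Adj G u' v' →
                 ((face u v ≡ face u' v') ⇔
                  (∃[ j ] iter (facePerm ρ) j (u , v) ≡ (u' , v')))
    euler  : ∣ V G ∣ + F ≡ 2 + numEdges G

-- G is planar: it has a spherical embedding, or it has no edges
-- (the rotation-system description of faces needs at least one edge;
-- an edgeless connected graph is K₁, which is planar).
Planar : ∀ {N} → Graph N → Set
Planar G = (∀ u v → adj G u v ≡ false) ⊎ SphericalEmbedding G

-- The class of k-connected planar graphs (graphs are connected by the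
-- standing assumption).

KConnPlanar : ∀ {N} → ℕ → Graph N → Set
KConnPlanar k G = Connected G × KConnected k G × Planar G

T3Reconstructible : (∀ {N} → Graph N → Set) → Set
T3Reconstructible C =
  ∀ (N : ℕ) (G₁ G₂ : Graph N) → C G₁ → C G₂ → ¬ Identical G₁ G₂ → ¬ SameT3 G₁ G₂

{-# OPTIONS --safe #-}
-- In an embedding of genus 0 every cycle C is the set of edges across which some 2-colouring c of the
-- faces changes: over F₂, the data (vertex set S, face colouring c, scalar t) has |V| + |F| + 1 = |E| + 3
-- bits, so two linear conditions can be imposed on a nonzero triple with P_S + δc + tC = 0, where P_S joins
-- each vertex of S to a root; taking boundaries kills S, and connectivity then excludes t = 0.  Such a
-- colouring shows that if u and v have four common neighbours, in this order b, d, e, p around u, then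
-- the 4-cycle u p v d separates b from e.  So in a 5-connected planar graph two vertices never have four
-- common neighbours.  If uv is an edge of G₁ only, however, then equality of T₃ makes every neighbour
-- of u in G₁ other than v a common neighbour of u and v in G₂.  For k ≤ 4 two octahedra on the same
-- vertices are ambiguous, and for k ≥ 6 the minimum degree contradicts Euler's formula.

module Submission where

open import Defs
open import Data.Nat using (ℕ; _≤_)
open import Data.Product using (_×_)
open import Relation.Nullary using (¬_)

open import Algebra.Bundles using (CommutativeRing)
import Algebra.Properties.CommutativeMonoid.Sum as CommutativeMonoidSum
open import Data.Bool as Bool using (Bool; true; false; not; _∧_; _xor_; if_then_else_)
open import Data.Bool.Properties
  using (∧-comm; ∧-identityʳ; ∧-zeroʳ; ∧-distribˡ-xor; ∧-distribʳ-xor; not-¬;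
         xor-assoc; xor-comm; xor-same; xor-identityʳ; xor-∧-commutativeRing)
import Data.Empty as Empty
open import Data.Fin as Fin
  using (Fin; zero; suc; toℕ; #_; cast; combine; remQuot; finToFun; funToFin; splitAt; join; _↑ˡ_; _↑ʳ_)
open import Data.Fin.Permutation using (permutation)
open import Data.Fin.Properties as Fin
  using (_≟_; any?; all?; ¬∀⟶∃¬; pigeonhole; injective⇒≤; suc-injective; punchOut-injective;
         remQuot-combine; combine-remQuot; cast-involutive; funToFin-finToFin; finToFun-funToFin; join-splitAt; 2↔Bool)
open import Data.Fin.Subset using (Subset; _∈_; _∉_; _⊆_; _─_; _∪_; ⁅_⁆; ∣_∣; ⊤; ⊥)
open import Data.Fin.Subset.Properties
  using (_∈?_; p⊆q⇒∣p∣≤∣q∣; x∈p∪q⁻; x∈p∪q⁺; x∈⁅x⁆; x∈⁅y⁆⇒x≡y; ∉⊥; ∈⊤; ∪-identityˡ; p─⊥≡p;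
         x∈p∧x∉q⇒x∈p─q; ∣⊥∣≡0; ⊆-antisym)
open import Data.List as List using (List; []; _∷_; _++_; concatMap; length; map)
open import Data.List.Membership.Propositional using (lose) renaming (_∈_ to _∈ˡ_; _∉_ to _∉ˡ_)
open import Data.List.Membership.Propositional.Properties using (∈-concatMap⁺; ∈-allFin; ∈-lookup)
open import Data.List.Properties using (length-++; ++-identityʳ)
open import Data.List.Relation.Unary.All as All using (All; []; _∷_)
open import Data.List.Relation.Unary.All.Properties as All using (¬Any⇒All¬)
open import Data.List.Relation.Unary.AllPairs using ([]; _∷_)
open import Data.List.Relation.Unary.Any as Any using (here; there)
open import Data.List.Relation.Unary.Any.Properties using (lookup-index)
open import Data.List.Relation.Unary.Unique.Propositional using (Unique)
open import Data.Nat as ℕ using (zero; suc; _+_; _*_; _^_; _<_; z≤n; s≤s)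
open import Data.Nat.DivMod using (_mod_)
open import Data.Nat.Induction using (<-wellFounded; Acc; acc)
open import Data.Nat.ListAction using (sum)
import Data.Nat.Properties as ℕ
open import Data.Nat.Tactic.RingSolver using (solve-∀)
open import Data.Product using (_,_; ∃-syntax; proj₁; proj₂; swap)
open import Data.Product.Properties using (,-injectiveˡ; ,-injectiveʳ; ≡-dec)
open import Data.Sum using (_⊎_; inj₁; inj₂)
open import Data.Vec as Vec using ([]; _∷_; here; there)
open import Function using (_∘_; id; Inverse; Injection; Equivalence; mk⇔)
open import Function.Construct.Symmetry using (↔-sym)
open import Function.Definitions using (Injective)
open import Function.Properties.Inverse using (↔⇒↣)
open import Relation.Binary using (Tri; tri<; tri≈; tri>)
open import Relation.Binary.PropositionalEquality as ≡
  using (_≡_; _≢_; _≗_; refl; trans; cong; cong₂; subst; module ≡-Reasoning)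
open import Relation.Nullary using (Dec; yes; no; does; contradiction)
open import Relation.Nullary.Decidable
  using (dec-true; dec-false; decidable-stable; map′; toWitness; ¬?; _→-dec_; _×-dec_; _⊎-dec_)

open CommutativeMonoidSum (CommutativeRing.+-commutativeMonoid xor-∧-commutativeRing)
  using (∑-distrib-+; ∑-comm; sum-permute; sum-cong-≗; sum-replicate-zero)
  renaming (sum to ⨁)

-- Linear algebra over F₂

xor-interchange : ∀ a b c d → (a xor b) xor (c xor d) ≡ (a xor c) xor (b xor d)
xor-interchange false false c d = refl
xor-interchange false true false d = refl
xor-interchange false true true false = refl
xor-interchange false true true true = refl
xor-interchange true false false d = refl
xor-interchange true false true false = refl
xor-interchange true false true true = refl
xor-interchange true true false false = refl
xor-interchange true true false true = refl
xor-interchange true true true false = refl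
xor-interchange true true true true = refl

xor-eq-false : ∀ a b → a xor b ≡ false → a ≡ b
xor-eq-false false false _ = refl
xor-eq-false true true _ = refl

≟-sym : ∀ {n} (i j : Fin n) → does (i ≟ j) ≡ does (j ≟ i)
≟-sym i j with i ≟ j
... | yes refl = ≡.sym (dec-true (i ≟ i) refl)
... | no i≢j = ≡.sym (dec-false (j ≟ i) (i≢j ∘ ≡.sym))

≟-injective : ∀ {m n} (f : Fin m → Fin n) → Injective _≡_ _≡_ f → ∀ i j → does (f i ≟ f j) ≡ does (i ≟ j)
≟-injective f f-inj i j with i ≟ j
... | yes refl = dec-true (f i ≟ f i) refl
... | no i≢j = dec-false (f i ≟ f j) (i≢j ∘ f-inj)

⨁-zero : ∀ {n} (f : Fin n → Bool) → (∀ i → f i ≡ false) → ⨁ f ≡ false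
⨁-zero {n} f f≡0 = trans (sum-cong-≗ f≡0) (sum-replicate-zero n)

⨁-∧ : ∀ {n} b (f : Fin n → Bool) → ⨁ (λ i → b ∧ f i) ≡ b ∧ ⨁ f
⨁-∧ true f = refl
⨁-∧ {n} false f = sum-replicate-zero n

⨁-select : ∀ {n} (f : Fin n → Bool) j → ⨁ (λ i → f i ∧ does (i ≟ j)) ≡ f j
⨁-select {suc n} f zero = trans
  (cong₂ _xor_ (∧-identityʳ (f zero)) (⨁-zero {n} _ (λ i → ∧-zeroʳ (f (suc i)))))
  (xor-identityʳ (f zero))
⨁-select {suc n} f (suc j) = cong₂ _xor_ (∧-zeroʳ (f zero)) (⨁-select (f ∘ suc) j)

-- If `y` were missed, punching it out would give an injection from `Fin (suc n)` into `Fin n`.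
injective⇒surjective : ∀ {n} (f : Fin n → Fin n) → Injective _≡_ _≡_ f → ∀ y → ∃[ x ] f x ≡ y
injective⇒surjective {suc n} f f-inj y with any? (λ x → f x ≟ y)
... | yes hit = hit
... | no miss = contradiction (injective⇒≤ g-inj) ℕ.1+n≰n
  where
  g-inj : Injective _≡_ _≡_ (λ x → Fin.punchOut {i = y} {j = f x} (λ eq → miss (x , ≡.sym eq)))
  g-inj {x} {x′} = f-inj ∘ punchOut-injective (λ eq → miss (x , ≡.sym eq)) (λ eq → miss (x′ , ≡.sym eq))

⨁-reindex : ∀ {n} (π : Fin n → Fin n) → Injective _≡_ _≡_ π → ∀ f → ⨁ f ≡ ⨁ (f ∘ π)
⨁-reindex π π-inj f = sum-permute f
  (permutation π (proj₁ ∘ onto) (proj₂ ∘ onto) (λ x → π-inj (proj₂ (onto (π x)))))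
  where onto = injective⇒surjective π π-inj

funToFin-cong : ∀ {m n} {f g : Fin m → Fin n} → f ≗ g → funToFin f ≡ funToFin g
funToFin-cong {zero} f≗g = refl
funToFin-cong {suc m} f≗g = cong₂ combine (f≗g zero) (funToFin-cong (f≗g ∘ suc))

abstract
  -- The two halves of a pigeonhole collision differ by a kernel element.
  kernel-nontrivial : ∀ {m n} → m < n → (f : (Fin n → Bool) → Fin m → Bool) →
    (∀ x y j → f (λ i → x i xor y i) j ≡ f x j xor f y j) →
    ∃[ x ] (¬ (∀ i → x i ≡ false)) × (∀ j → f x j ≡ false)
  kernel-nontrivial {m} {n} m<n f f-additive = x , x≢0 , fx≡0
    where
    -- Vectors and their images are coded as numbers below `2 ^ n` and `2 ^ m`, because `pigeonhole`
    -- concerns maps between `Fin` types.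
    bits : ∀ {k} → Fin (2 ^ k) → Fin k → Bool
    bits a = Inverse.to 2↔Bool ∘ finToFun a

    image : Fin (2 ^ n) → Fin (2 ^ m)
    image a = funToFin (Inverse.from 2↔Bool ∘ f (bits a))

    collision : ∃[ i ] ∃[ j ] i Fin.< j × image i ≡ image j
    collision = pigeonhole (ℕ.^-monoʳ-< 2 (s≤s (s≤s z≤n)) m<n) image
    a b : Fin (2 ^ n)
    a = proj₁ collision
    b = proj₁ (proj₂ collision)

    x : Fin n → Bool
    x i = bits a i xor bits b i

    x≢0 : ¬ (∀ i → x i ≡ false)
    x≢0 x≡0 = Fin.<-irrefl a≡b (proj₁ (proj₂ (proj₂ collision)))
      where
      a≡b : a ≡ b
      a≡b = trans (≡.sym (funToFin-finToFin {n} a)) (trans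
        (funToFin-cong (λ i → Injection.injective (↔⇒↣ 2↔Bool) (xor-eq-false _ _ (x≡0 i)))) (funToFin-finToFin {n} b))

    fx≡0 : ∀ j → f x j ≡ false
    fx≡0 j = begin
      f x j                       ≡⟨ f-additive (bits a) (bits b) j ⟩
      f (bits a) j xor f (bits b) j ≡⟨ cong (_xor f (bits b) j) (Injection.injective (↔⇒↣ (↔-sym 2↔Bool)) same) ⟩
      f (bits b) j xor f (bits b) j ≡⟨ xor-same (f (bits b) j) ⟩
      false ∎
      where
      open ≡-Reasoning
      same : Inverse.from 2↔Bool (f (bits a) j) ≡ Inverse.from 2↔Bool (f (bits b) j)
      same = begin
        _ ≡⟨ finToFun-funToFin (Inverse.from 2↔Bool ∘ f (bits a)) j ⟨
        finToFun (image a) j ≡⟨ cong (λ q → finToFun {2} {m} q j) (proj₂ (proj₂ (proj₂ collision))) ⟩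
        finToFun (image b) j ≡⟨ finToFun-funToFin (Inverse.from 2↔Bool ∘ f (bits b)) j ⟩
        _ ∎

-- Graphs and chains modulo 2

adj-sym : ∀ {N} (G : Graph N) u v → adj G u v ≡ adj G v u
adj-sym G u v with adj G u v in uv | adj G v u in vu
... | true | true = refl
... | false | false = refl
... | true | false = trans (≡.sym (Defs.sym G u v uv)) vu
... | false | true = trans (≡.sym uv) (Defs.sym G v u vu)

Adj⇒≢ : ∀ {N} (G : Graph N) {u v} → Adj G u v → u ≢ v
Adj⇒≢ G {u} uv refl = contradiction (trans (≡.sym uv) (loopless G u)) λ()

inVʳ : ∀ {N} (G : Graph N) {u v} → Adj G u v → v ∈ V G
inVʳ G {u} {v} uv = inV G v u (Defs.sym G u v uv)

-- A 1-chain modulo 2, as a matrix with each edge entered in both directions, so that the row sum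
-- `∂ D x` counts modulo 2 the edges of `D` at `x`. Symmetry is imposed by `ChainOn`.
Chain : ℕ → Set
Chain N = Fin N → Fin N → Bool

∂ : ∀ {N} → Chain N → Fin N → Bool
∂ D x = ⨁ (D x)

_⊕_ : ∀ {N} → Chain N → Chain N → Chain N
(D ⊕ D′) x y = D x y xor D′ x y

record ChainOn {N} (G : Graph N) (D : Chain N) : Set where
  field
    symmetric : ∀ x y → D x y ≡ D y x
    supported : ∀ x y → adj G x y ≡ false → D x y ≡ false
open ChainOn

⊕-chainOn : ∀ {N} {G : Graph N} {D D′} → ChainOn G D → ChainOn G D′ → ChainOn G (D ⊕ D′)
⊕-chainOn d d′ .symmetric x y = cong₂ _xor_ (symmetric d x y) (symmetric d′ x y)
⊕-chainOn d d′ .supported x y xy = cong₂ _xor_ (supported d x y xy) (supported d′ x y xy)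

combination : ∀ {n N} → (Fin n → Bool) → (Fin n → Chain N) → Chain N
combination s D x y = ⨁ (λ i → s i ∧ D i x y)

combination-chainOn : ∀ {n N} {G : Graph N} (s : Fin n → Bool) {D : Fin n → Chain N} →
  (∀ i → ChainOn G (D i)) → ChainOn G (combination s D)
combination-chainOn s d .symmetric x y = sum-cong-≗ (λ i → cong (s i ∧_) (symmetric (d i) x y))
combination-chainOn s d .supported x y xy =
  ⨁-zero _ (λ i → trans (cong (s i ∧_) (supported (d i) x y xy)) (∧-zeroʳ (s i)))

∂-combination : ∀ {n N} (s : Fin n → Bool) (D : Fin n → Chain N) x →
  ∂ (combination s D) x ≡ ⨁ (λ i → s i ∧ ∂ (D i) x)
∂-combination s D x = trans (∑-comm (λ y i → s i ∧ D i x y)) (sum-cong-≗ (λ i → ⨁-∧ (s i) (D i x)))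

edge : ∀ {N} → Fin N → Fin N → Chain N
edge u w x y = (does (x ≟ u) ∧ does (y ≟ w)) xor (does (x ≟ w) ∧ does (y ≟ u))

∂-edge : ∀ {N} (u w x : Fin N) → ∂ (edge u w) x ≡ does (x ≟ u) xor does (x ≟ w)
∂-edge u w x = trans
  (∑-distrib-+ (λ y → does (x ≟ u) ∧ does (y ≟ w)) (λ y → does (x ≟ w) ∧ does (y ≟ u)))
  (cong₂ _xor_ (⨁-select (λ _ → does (x ≟ u)) w) (⨁-select (λ _ → does (x ≟ w)) u))

edge-false : ∀ {N} (u w x y : Fin N) → ¬ (x ≡ u × y ≡ w) → ¬ (x ≡ w × y ≡ u) → edge u w x y ≡ false
edge-false u w x y ≢uw ≢wu = cong₂ _xor_ (disjoint ≢uw) (disjoint ≢wu)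
  where
  disjoint : ∀ {a b} → ¬ (x ≡ a × y ≡ b) → does (x ≟ a) ∧ does (y ≟ b) ≡ false
  disjoint {a} {b} ≢ab with x ≟ a | y ≟ b
  ... | yes x≡a | yes y≡b = contradiction (x≡a , y≡b) ≢ab
  ... | yes _ | no _ = refl
  ... | no _ | _ = refl

edge-chainOn : ∀ {N} {G : Graph N} {u w} → Adj G u w → ChainOn G (edge u w)
edge-chainOn {u = u} {w} uw .symmetric x y = trans
  (cong₂ _xor_ (∧-comm (does (x ≟ u)) _) (∧-comm (does (x ≟ w)) _)) (xor-comm (does (y ≟ w) ∧ _) _)
edge-chainOn {G = G} {u} {w} uw .supported x y xy = edge-false u w x y
  (λ { (refl , refl) → contradiction (trans (≡.sym uw) xy) λ() })
  (λ { (refl , refl) → contradiction (trans (≡.sym (Defs.sym G u w uw)) xy) λ() })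

-- Edges are added modulo 2, so an edge traversed twice cancels.
walkChain : ∀ {N} {G : Graph N} {S u v} → WalkIn G S u v → Chain N
walkChain (stop _) = λ _ _ → false
walkChain (step {u} {w} _ _ p) = edge u w ⊕ walkChain p

walkChain-chainOn : ∀ {N} {G : Graph N} {S u v} (p : WalkIn G S u v) → ChainOn G (walkChain p)
walkChain-chainOn (stop _) = record { symmetric = λ _ _ → refl ; supported = λ _ _ _ → refl }
walkChain-chainOn (step _ uw p) = ⊕-chainOn (edge-chainOn uw) (walkChain-chainOn p)

-- Inner vertices cancel in pairs; in particular a closed walk has zero boundary.
∂-walkChain : ∀ {N} {G : Graph N} {S u v} (p : WalkIn G S u v) x →
  ∂ (walkChain p) x ≡ does (x ≟ u) xor does (x ≟ v)
∂-walkChain {N} (stop {u} _) x = trans (sum-replicate-zero N) (≡.sym (xor-same (does (x ≟ u))))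
∂-walkChain {v = v} (step {u} {w} _ _ p) x = begin
  ∂ (edge u w ⊕ walkChain p) x                       ≡⟨ ∑-distrib-+ (edge u w x) (walkChain p x) ⟩
  ∂ (edge u w) x xor ∂ (walkChain p) x               ≡⟨ cong₂ _xor_ (∂-edge u w x) (∂-walkChain p x) ⟩
  (xᵤ xor xʷ) xor (xʷ xor xᵥ)                        ≡⟨ xor-assoc xᵤ xʷ (xʷ xor xᵥ) ⟩
  xᵤ xor (xʷ xor (xʷ xor xᵥ))                        ≡⟨ cong (xᵤ xor_) (xor-assoc xʷ xʷ xᵥ) ⟨
  xᵤ xor ((xʷ xor xʷ) xor xᵥ)                        ≡⟨ cong (λ z → xᵤ xor (z xor xᵥ)) (xor-same xʷ) ⟩
  xᵤ xor xᵥ ∎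
  where
  open ≡-Reasoning
  xᵤ = does (x ≟ u)
  xʷ = does (x ≟ w)
  xᵥ = does (x ≟ v)

-- Colour changes around the faces of an embedding

module Embedding {N} {G : Graph N} (E : SphericalEmbedding G) where
  open SphericalEmbedding E

  face-next : ∀ {u v} → Adj G u v → face u v ≡ face v (ρ v u)
  face-next {u} {v} uv = Equivalence.from
    (face-orbit u v v (ρ v u) uv (ρ-adj v u (Defs.sym G u v uv))) (1 , refl)

  iter-adj : ∀ {u x} j → Adj G u x → Adj G u (iter (ρ u) j x)
  iter-adj zero ux = ux
  iter-adj (suc j) ux = ρ-adj _ _ (iter-adj j ux)

  -- The coboundary of `c` in the dual graph: `face x y` and `face y x` are the two sides of the
  -- edge `xy`.
  δ : (Fin F → Bool) → Chain N
  δ c x y = adj G x y ∧ (c (face x y) xor c (face y x))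

  δ-chainOn : ∀ c → ChainOn G (δ c)
  δ-chainOn c .symmetric x y = cong₂ _∧_ (adj-sym G x y) (xor-comm (c (face x y)) _)
  δ-chainOn c .supported x y xy = cong (_∧ _) xy

  -- Around a vertex the left sides of the darts are the right sides rotated.
  ∂-δ : ∀ c x → ∂ (δ c) x ≡ false
  ∂-δ c x = begin
    ⨁ (δ c x)                      ≡⟨ sum-cong-≗ (λ y → ∧-distribˡ-xor (adj G x y) (c (face x y)) (c (face y x))) ⟩
    ⨁ (λ y → out y xor inc y)      ≡⟨ ∑-distrib-+ out inc ⟩
    ⨁ out xor ⨁ inc                ≡⟨ cong (⨁ out xor_) (sum-cong-≗ inc≗out∘π) ⟩
    ⨁ out xor ⨁ (out ∘ π)          ≡⟨ cong (⨁ out xor_) (⨁-reindex π π-inj out) ⟨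
    ⨁ out xor ⨁ out                ≡⟨ xor-same (⨁ out) ⟩
    false ∎
    where
    open ≡-Reasoning
    out inc : Fin N → Bool
    out y = adj G x y ∧ c (face x y)
    inc y = adj G x y ∧ c (face y x)

    -- The rotation at `x`, extended by the identity to a permutation of all labels.
    π : Fin N → Fin N
    π y = if adj G x y then ρ x y else y

    π-inj : Injective _≡_ _≡_ π
    π-inj {y} {z} eq with adj G x y in xy | adj G x z in xz
    ... | true | true = ρ-inj x y z xy xz eq
    ... | false | false = eq
    ... | true | false = contradiction
      (trans (≡.sym (ρ-adj x y xy)) (trans (cong (adj G x) eq) xz)) λ()
    ... | false | true = contradiction
      (trans (≡.sym (ρ-adj x z xz)) (trans (cong (adj G x) (≡.sym eq)) xy)) λ()

    -- On its face the dart from `y` to `x` is followed by the dart from `x` to `ρ x y`.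
    inc≗out∘π : inc ≗ out ∘ π
    inc≗out∘π y with adj G x y in xy
    ... | true rewrite ρ-adj x y xy = cong c (face-next (Defs.sym G x y xy))
    ... | false rewrite xy = refl

  Uncut : (Fin F → Bool) → Fin N → Set
  Uncut c x = ∀ y → Adj G x y → c (face x y) ≡ c (face y x)

  -- Crossing an edge at `x` leads to the face of the next dart around `x`, and the rotation reaches
  -- every neighbour.
  uncut-vertex : ∀ c {x y z} → Uncut c x → Adj G x y → Adj G x z → c (face x y) ≡ c (face x z)
  uncut-vertex c {x} {y} {z} uncut xy xz = trans (rotated (proj₁ j)) (cong (c ∘ face x) (proj₂ j))
    where
    j = ρ-cyc x y z xy xz
    rotated : ∀ j → c (face x y) ≡ c (face x (iter (ρ x) j y))
    rotated zero = refl
    rotated (suc j) = trans (rotated j) (trans (uncut _ (iter-adj j xy))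
      (cong c (face-next (Defs.sym G x _ (iter-adj j xy)))))

  -- At each vertex of the walk the colour is carried around to the next edge of the walk and then
  -- across that edge.
  uncut-walk : ∀ c {S a b y z} → (∀ {x} → x ∈ S → Uncut c x) → WalkIn G S a b →
    Adj G a y → Adj G b z → c (face a y) ≡ c (face b z)
  uncut-walk c uncut (stop a∈S) ay bz = uncut-vertex c (uncut a∈S) ay bz
  uncut-walk c uncut (step {u} {w} a∈S aw p) ay bz = trans (uncut-vertex c (uncut a∈S) ay aw)
    (trans (uncut a∈S w aw) (uncut-walk c uncut p (Defs.sym G u w aw) bz))

  uncut-constant : ∀ c → ConnectedOn G (V G) → (∀ x → Uncut c x) → ∀ f g → c f ≡ c g
  uncut-constant c conn uncut f g
    with u , v , uv , refl ← face-surj f | x , y , xy , refl ← face-surj g =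
    uncut-walk c (λ {x} _ → uncut x) (conn u x (inV G u v uv) (inV G x y xy)) uv xy

-- Counting vertices, edges and darts

elementAt : ∀ {n} (p : Subset n) → Fin ∣ p ∣ → Fin n
elementAt (true ∷ p) zero = zero
elementAt (true ∷ p) (suc i) = suc (elementAt p i)
elementAt (false ∷ p) i = suc (elementAt p i)

elementAt-∈ : ∀ {n} (p : Subset n) i → elementAt p i ∈ p
elementAt-∈ (true ∷ p) zero = here
elementAt-∈ (true ∷ p) (suc i) = there (elementAt-∈ p i)
elementAt-∈ (false ∷ p) i = there (elementAt-∈ p i)

elementAt-injective : ∀ {n} (p : Subset n) → Injective _≡_ _≡_ (elementAt p)
elementAt-injective (true ∷ p) {zero} {zero} eq = refl
elementAt-injective (true ∷ p) {suc i} {suc j} eq = cong suc (elementAt-injective p (suc-injective eq))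
elementAt-injective (false ∷ p) eq = elementAt-injective p (suc-injective eq)

elementAt-surjective : ∀ {n} (p : Subset n) {x} → x ∈ p → ∃[ i ] elementAt p i ≡ x
elementAt-surjective (true ∷ p) here = zero , refl
elementAt-surjective (true ∷ p) (there x∈p) with i , refl ← elementAt-surjective p x∈p = suc i , refl
elementAt-surjective (false ∷ p) (there x∈p) with i , refl ← elementAt-surjective p x∈p = i , refl

⊈⇒witness : ∀ {n} (p q : Subset n) → ∣ q ∣ < ∣ p ∣ → ∃[ x ] x ∈ p × x ∉ q
⊈⇒witness {n} p q q<p with ¬∀⟶∃¬ n (λ x → x ∈ p → x ∈ q) (λ x → (x ∈? p) →-dec (x ∈? q))
  (λ p⊆q → ℕ.<⇒≱ q<p (p⊆q⇒∣p∣≤∣q∣ (λ {x} → p⊆q x)))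
... | x , ¬p→q = x , decidable-stable (x ∈? p) (λ x∉p → ¬p→q (λ x∈p → contradiction x∈p x∉p)) , λ x∈q → ¬p→q (λ _ → x∈q)

fromList : ∀ {n} → List (Fin n) → Subset n
fromList = List.foldr (λ x p → ⁅ x ⁆ ∪ p) ⊥

∈-fromList⁺ : ∀ {n} {x : Fin n} {xs} → x ∈ˡ xs → x ∈ fromList xs
∈-fromList⁺ (here refl) = x∈p∪q⁺ (inj₁ (x∈⁅x⁆ _))
∈-fromList⁺ (there x∈xs) = x∈p∪q⁺ (inj₂ (∈-fromList⁺ x∈xs))

∈-fromList⁻ : ∀ {n} {x : Fin n} xs → x ∈ fromList xs → x ∈ˡ xs
∈-fromList⁻ [] x∈⊥ = contradiction x∈⊥ ∉⊥
∈-fromList⁻ (y ∷ ys) x∈ with x∈p∪q⁻ ⁅ y ⁆ (fromList ys) x∈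
... | inj₁ x∈y = here (x∈⁅y⁆⇒x≡y y x∈y)
... | inj₂ x∈ys = there (∈-fromList⁻ ys x∈ys)

fromList-⊆ : ∀ {n} {xs} {p : Subset n} → All (_∈ p) xs → fromList xs ⊆ p
fromList-⊆ {xs = xs} all x∈ = All.lookup all (∈-fromList⁻ xs x∈)

∣⁅x⁆∪p∣ : ∀ {n} (x : Fin n) p → x ∉ p → ∣ ⁅ x ⁆ ∪ p ∣ ≡ suc ∣ p ∣
∣⁅x⁆∪p∣ zero (true ∷ p) x∉p = contradiction here x∉p
∣⁅x⁆∪p∣ zero (false ∷ p) x∉p = cong (suc ∘ ∣_∣) (∪-identityˡ p)
∣⁅x⁆∪p∣ (suc x) (true ∷ p) x∉p = cong suc (∣⁅x⁆∪p∣ x p (x∉p ∘ there))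
∣⁅x⁆∪p∣ (suc x) (false ∷ p) x∉p = ∣⁅x⁆∪p∣ x p (x∉p ∘ there)

∣fromList∣ : ∀ {n} {xs : List (Fin n)} → Unique xs → ∣ fromList xs ∣ ≡ length xs
∣fromList∣ {n} [] = ∣⊥∣≡0 n
∣fromList∣ {xs = x ∷ xs} (x≢xs ∷ uniq) = trans
  (∣⁅x⁆∪p∣ x (fromList xs) (λ x∈ → All.lookup x≢xs (∈-fromList⁻ xs x∈) refl))
  (cong suc (∣fromList∣ uniq))

∷-unique : ∀ {A : Set} {x : A} {xs} → x ∉ˡ xs → Unique xs → Unique (x ∷ xs)
∷-unique x∉xs uniq = ¬Any⇒All¬ _ x∉xs ∷ uniq

lookup-injective : ∀ {A : Set} {xs : List A} → Unique xs → Injective _≡_ _≡_ (List.lookup xs)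
lookup-injective (_ ∷ _) {zero} {zero} eq = refl
lookup-injective {xs = _ ∷ xs} (x≢xs ∷ _) {zero} {suc j} eq = contradiction eq (All.lookup x≢xs (∈-lookup j))
lookup-injective {xs = _ ∷ xs} (x≢xs ∷ _) {suc i} {zero} eq = contradiction (≡.sym eq) (All.lookup x≢xs (∈-lookup i))
lookup-injective (_ ∷ uniq) {suc i} {suc j} eq = cong suc (lookup-injective uniq eq)

length-concatMap : ∀ {A B : Set} (f : A → List B) (g : A → ℕ) → (∀ x → length (f x) ≡ g x) →
  ∀ xs → length (concatMap f xs) ≡ sum (map g xs)
length-concatMap f g f≗g [] = refl
length-concatMap f g f≗g (x ∷ xs) = trans (length-++ (f x)) (cong₂ _+_ (f≗g x) (length-concatMap f g f≗g xs))

module _ {N} (G : Graph N) where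

  -- The conditionals copy those of `numEdges`, so the length of `edges` agrees with it summand by
  -- summand.
  edgesAt : Fin N → Fin N → List (Fin N × Fin N)
  edgesAt u v = if does (u Fin.<? v) then (if adj G u v then (u , v) ∷ [] else []) else []

  edges : List (Fin N × Fin N)
  edges = concatMap (λ u → concatMap (edgesAt u) (List.allFin N)) (List.allFin N)

  length-edges : length edges ≡ numEdges G
  length-edges = length-concatMap _ _ (λ u → length-concatMap _ _ (single u) (List.allFin N)) (List.allFin N)
    where
    single : ∀ u v → length (edgesAt u v) ≡ (if does (u Fin.<? v) then (if adj G u v then 1 else 0) else 0)
    single u v with does (u Fin.<? v) | adj G u v
    ... | true | true = refl
    ... | true | false = refl
    ... | false | _ = refl

  ∈-edges : ∀ {u v} → Adj G u v → u Fin.< v → (u , v) ∈ˡ edges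
  ∈-edges {u} {v} uv u<v = ∈-concatMap⁺ _ (lose (∈-allFin u) (∈-concatMap⁺ _ (lose (∈-allFin v) here!)))
    where
    here! : (u , v) ∈ˡ edgesAt u v
    here! rewrite dec-true (u Fin.<? v) u<v | uv = here refl

  edgeAt : Fin (numEdges G) → Fin N × Fin N
  edgeAt e = List.lookup edges (cast (≡.sym length-edges) e)

  edgeAt-surjective : ∀ {u v} → Adj G u v → u Fin.< v → ∃[ e ] edgeAt e ≡ (u , v)
  edgeAt-surjective uv u<v = cast length-edges (Any.index uv∈) , (begin
    _ ≡⟨ cong (List.lookup edges) (cast-involutive (≡.sym length-edges) length-edges (Any.index uv∈)) ⟩
    _ ≡⟨ lookup-index uv∈ ⟨
    _ ∎)
    where
    open ≡-Reasoning
    uv∈ = ∈-edges uv u<v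

  orient : Fin (numEdges G) × Fin 2 → Fin N × Fin N
  orient (e , zero) = edgeAt e
  orient (e , suc zero) = swap (edgeAt e)

  dartAt : Fin (numEdges G * 2) → Fin N × Fin N
  dartAt d = orient (remQuot 2 d)

  dartAt-surjective : ∀ {u v} → Adj G u v → ∃[ d ] dartAt d ≡ (u , v)
  dartAt-surjective {u} {v} uv with Fin.<-cmp u v
  ... | tri< u<v _ _ with e , eq ← edgeAt-surjective uv u<v =
    combine e zero , trans (cong orient (remQuot-combine e zero)) eq
  ... | tri≈ _ refl _ = contradiction refl (Adj⇒≢ G uv)
  ... | tri> _ _ v<u with e , eq ← edgeAt-surjective (Defs.sym G u v uv) v<u =
    combine e (suc zero) , trans (cong orient (remQuot-combine e (suc zero))) (cong swap eq)

  -- The double counts of vertex degrees and of face lengths both rest on this bound. Every dart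
  -- gets an index among the two orientations of all edges, and equal indices give equal darts.
  darts-≤ : ∀ {m} (d : Fin m → Fin N × Fin N) → Injective _≡_ _≡_ d →
    (∀ i → Adj G (proj₁ (d i)) (proj₂ (d i))) → m ≤ numEdges G * 2
  darts-≤ {m} d d-inj d-adj = injective⇒≤ {f = proj₁ ∘ code} (λ {i} {j} eq →
    d-inj (trans (≡.sym (proj₂ (code i))) (trans (cong dartAt eq) (proj₂ (code j)))))
    where
    code : ∀ i → ∃[ k ] dartAt k ≡ d i
    code i = dartAt-surjective (d-adj i)

-- Vertex degrees in k-connected graphs

x∈p─q⇒x∉q : ∀ {n} {x : Fin n} (p q : Subset n) → x ∈ p ─ q → x ∉ q
x∈p─q⇒x∉q (_ ∷ _) (true ∷ _) () here
x∈p─q⇒x∉q (_ ∷ p) (_ ∷ q) (there x∈) (there x∈q) = x∈p─q⇒x∉q p q x∈ x∈q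

walk-start : ∀ {N} {G : Graph N} {S u v} → WalkIn G S u v → u ∈ S
walk-start (stop u∈S) = u∈S
walk-start (step u∈S _ _) = u∈S

module _ {N k} {G : Graph N} (kconn : KConnected k G) where

  -- Since `X` together with `x` has at most `k` elements, some vertex `z` lies outside; a walk from
  -- `x` to `z` avoiding `X` starts with the wanted edge.
  neighbour-outside : ∀ {x} X → x ∈ V G → X ⊆ V G → ∣ X ∣ < k → x ∉ X → ∃[ y ] Adj G x y × y ∉ X
  neighbour-outside {x} X x∈V X⊆V X<k x∉X
    with z , z∈V , z∉ ← ⊈⇒witness (V G) (⁅ x ⁆ ∪ X)
      (subst (_< ∣ V G ∣) (≡.sym (∣⁅x⁆∪p∣ x X x∉X)) (ℕ.≤-<-trans X<k (proj₁ kconn)))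
    with proj₂ kconn X X⊆V X<k x z (x∈p∧x∉q⇒x∈p─q x∈V x∉X)
      (x∈p∧x∉q⇒x∈p─q z∈V (λ z∈X → z∉ (x∈p∪q⁺ (inj₂ z∈X))))
  ... | stop _ = contradiction (x∈p∪q⁺ (inj₁ (x∈⁅x⁆ x))) z∉
  ... | step {w = w} _ xw p = w , xw , x∈p─q⇒x∉q (V G) X (walk-start p)

  abstract
    -- The list `zs` holds forbidden vertices. Each new neighbour avoids `zs` and the neighbours
    -- already found, which together number fewer than `k`.
    neighbours : ∀ {x} zs → x ∈ V G → All (_∈ V G) zs → Unique zs → x ∉ˡ zs → ∀ m → m + length zs ≤ k →
      ∃[ ys ] length ys ≡ m × All (Adj G x) ys × Unique (ys ++ zs)
    neighbours zs x∈V zs∈V uniq x∉zs zero _ = [] , refl , [] , uniq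
    neighbours {x} zs x∈V zs∈V uniq x∉zs (suc m) m<k
      with ys , len , x~ys , uniq′ ← neighbours zs x∈V zs∈V uniq x∉zs m (ℕ.<⇒≤ m<k)
      with y , xy , y∉ ← neighbour-outside (fromList (ys ++ zs)) x∈V
        (fromList-⊆ (All.++⁺ (All.map (inVʳ G) x~ys) zs∈V))
        (subst (_< k) (≡.sym (trans (∣fromList∣ uniq′) (trans (length-++ ys) (cong (_+ length zs) len)))) m<k)
        (λ x∈ → All.lookup (All.++⁺ (All.map (Adj⇒≢ G) x~ys)
          (¬Any⇒All¬ zs x∉zs)) (∈-fromList⁻ (ys ++ zs) x∈) refl)
      = y ∷ ys , cong suc len , xy ∷ x~ys , ∷-unique (y∉ ∘ ∈-fromList⁺) uniq′

  neighbourAt : ∀ {x} m → x ∈ V G → m ≤ k →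
    ∃[ f ] Injective _≡_ _≡_ f × (∀ (i : Fin m) → Adj G x (f i))
  neighbourAt m x∈V m≤k
    with ys , refl , x~ys , uniq ← neighbours [] x∈V [] [] (λ ()) m (subst (_≤ k) (≡.sym (ℕ.+-identityʳ m)) m≤k)
    = List.lookup ys , lookup-injective (subst Unique (++-identityʳ ys) uniq) ,
      λ i → All.lookup x~ys (∈-lookup i)

remQuot-injective : ∀ {m} n → Injective _≡_ _≡_ (remQuot {m} n)
remQuot-injective {m} n {i} {j} eq = trans (≡.sym (combine-remQuot {m} n i))
  (trans (cong (λ (a , b) → combine a b) eq) (combine-remQuot {m} n j))

degree-count : ∀ {N} (G : Graph N) m →
  (∀ {x} → x ∈ V G → ∃[ f ] Injective _≡_ _≡_ f × (∀ (i : Fin m) → Adj G x (f i))) →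
  ∣ V G ∣ * m ≤ numEdges G * 2
degree-count {N} G m nbrs = darts-≤ G (dart ∘ remQuot m) (remQuot-injective m ∘ dart-injective)
  (λ i → let (a , b) = remQuot m i in proj₂ (proj₂ (nbrsOf a)) b)
  where
  nbrsOf : ∀ a → _
  nbrsOf a = nbrs (elementAt-∈ (V G) a)

  dart : Fin ∣ V G ∣ × Fin m → Fin N × Fin N
  dart (a , b) = elementAt (V G) a , proj₁ (nbrsOf a) b

  dart-injective : Injective _≡_ _≡_ dart
  dart-injective {a , b} {a′ , b′} eq with refl ← elementAt-injective (V G) (,-injectiveˡ eq) =
    cong (a ,_) (proj₁ (proj₂ (nbrsOf a)) (,-injectiveʳ eq))

-- Face lengths and Euler's formula

module _ {N} {G : Graph N} (E : SphericalEmbedding G) where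
  open SphericalEmbedding E
  open Embedding E

  -- A fixed point of the cyclic permutation `ρ v` would be the only neighbour of `v`.
  ρ-≢ : ∀ {u v w} → Adj G v u → Adj G v w → w ≢ u → ρ v u ≢ u
  ρ-≢ {u} {v} {w} vu vw w≢u fixed = w≢u (trans (≡.sym (proj₂ j)) (constant (proj₁ j)))
    where
    j = ρ-cyc v u w vu vw
    constant : ∀ j → iter (ρ v) j u ≡ u
    constant zero = refl
    constant (suc j) = trans (cong (ρ v) (constant j)) fixed

  -- Every face has three consecutive darts with distinct tails: a second neighbour of the middle
  -- vertex keeps the boundary from turning back at once.
  face-count : (∀ {u v} → Adj G u v → ∃[ w ] Adj G v w × w ≢ u) → F * 3 ≤ numEdges G * 2
  face-count other = darts-≤ G (dart ∘ remQuot 3) (remQuot-injective 3 ∘ dart-injective)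
    (λ i → dart-adj (remQuot 3 i))
    where
    dart : Fin F × Fin 3 → Fin N × Fin N
    dart (f , i) = let (u , v , _) = face-surj f in iter (facePerm ρ) (Fin.toℕ i) (u , v)

    dart-adj : ∀ fi → Adj G (proj₁ (dart fi)) (proj₂ (dart fi))
    dart-adj (f , i) with u , v , uv , _ ← face-surj f = go i
      where
      vρ = ρ-adj v u (Defs.sym G u v uv)
      go : (i : Fin 3) → let (x , y) = iter (facePerm ρ) (Fin.toℕ i) (u , v) in Adj G x y
      go zero = uv
      go (suc zero) = vρ
      go (suc (suc zero)) = ρ-adj _ v (Defs.sym G v _ vρ)

    dart-face : ∀ fi → face (proj₁ (dart fi)) (proj₂ (dart fi)) ≡ proj₁ fi
    dart-face (f , i) with u , v , uv , refl ← face-surj f = go i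
      where
      vρ = ρ-adj v u (Defs.sym G u v uv)
      go : (i : Fin 3) → let (x , y) = iter (facePerm ρ) (Fin.toℕ i) (u , v) in face x y ≡ face u v
      go zero = refl
      go (suc zero) = ≡.sym (face-next uv)
      go (suc (suc zero)) = ≡.sym (trans (face-next uv) (face-next vρ))

    dart-injective : Injective _≡_ _≡_ dart
    dart-injective {f , i} {f′ , i′} eq
      -- Equal darts lie on the same face; after that, equal tails force equal positions.
      with refl ← trans (≡.sym (dart-face (f , i))) (trans (cong (λ (x , y) → face x y) eq) (dart-face (f′ , i′)))
      with u , v , uv , _ ← face-surj f
      with w , vw , w≢u ← other uv = cong (f ,_) (go i i′ (,-injectiveˡ eq))
      where
      vu = Defs.sym G u v uv
      go : (i i′ : Fin 3) → proj₁ (iter (facePerm ρ) (Fin.toℕ i) (u , v)) ≡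
        proj₁ (iter (facePerm ρ) (Fin.toℕ i′) (u , v)) → i ≡ i′
      go zero zero _ = refl
      go zero (suc zero) u≡v = contradiction u≡v (Adj⇒≢ G uv)
      go zero (suc (suc zero)) u≡w = contradiction (≡.sym u≡w) (ρ-≢ vu vw w≢u)
      go (suc zero) zero v≡u = contradiction v≡u (Adj⇒≢ G vu)
      go (suc zero) (suc zero) _ = refl
      go (suc zero) (suc (suc zero)) v≡w = contradiction v≡w (Adj⇒≢ G (ρ-adj v u vu))
      go (suc (suc zero)) zero w≡u = contradiction w≡u (ρ-≢ vu vw w≢u)
      go (suc (suc zero)) (suc zero) w≡v = contradiction (≡.sym w≡v) (Adj⇒≢ G (ρ-adj v u vu))
      go (suc (suc zero)) (suc (suc zero)) _ = refl

-- In six times Euler's formula, `v * 6 ≤ e * 2` and twice `f * 3 ≤ e * 2` bound one side by `6e`,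
-- while the other is `6e + 12`.
euler-overflow : ∀ v f e → v + f ≡ 2 + e → v * 6 ≤ e * 2 → ¬ (f * 3 ≤ e * 2)
euler-overflow v f e euler 6v≤2e 3f≤2e = ℕ.m+1+n≰m (e * 2 + e * 2 * 2) (begin
  e * 2 + e * 2 * 2 + 12   ≡⟨ regroup e ⟩
  (2 + e) * 6              ≡⟨ cong (_* 6) euler ⟨
  (v + f) * 6              ≡⟨ expand v f ⟩
  v * 6 + f * 3 * 2        ≤⟨ ℕ.+-mono-≤ 6v≤2e (ℕ.*-monoˡ-≤ 2 3f≤2e) ⟩
  e * 2 + e * 2 * 2        ∎)
  where
  open ℕ.≤-Reasoning
  regroup : ∀ e → e * 2 + e * 2 * 2 + 12 ≡ (2 + e) * 6
  regroup = solve-∀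
  expand : ∀ v f → (v + f) * 6 ≡ v * 6 + f * 3 * 2
  expand = solve-∀

second-neighbour : ∀ {N k} {G : Graph N} → KConnected k G → 2 ≤ k → ∀ {u v} → Adj G u v → ∃[ w ] Adj G v w × w ≢ u
second-neighbour {G = G} kconn 2≤k {u} {v} uv with neighbourAt kconn 2 (inVʳ G uv) 2≤k
... | f , f-inj , v~ with f zero ≟ u
... | no f₀≢u = f zero , v~ zero , f₀≢u
... | yes f₀≡u = f (suc zero) , v~ (suc zero) , λ f₁≡u → contradiction (f-inj (trans f₀≡u (≡.sym f₁≡u))) λ ()

-- Degrees at least 6 and faces of length at least 3 contradict Euler's formula; an edgeless graph
-- fails because every vertex has a neighbour.
no-6-connected-planar : ∀ {N k} (G : Graph N) → 6 ≤ k → ¬ KConnPlanar k G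
no-6-connected-planar G 6≤k (((x , x∈V) , _) , kconn , inj₁ edgeless)
  with f , _ , x~ ← neighbourAt kconn 6 x∈V 6≤k =
  contradiction (trans (≡.sym (x~ zero)) (edgeless x (f zero))) λ ()
no-6-connected-planar G 6≤k (_ , kconn , inj₂ E) =
  euler-overflow ∣ V G ∣ (SphericalEmbedding.F E) (numEdges G) (SphericalEmbedding.euler E)
    (degree-count G 6 (λ x∈V → neighbourAt kconn 6 x∈V 6≤k))
    (face-count E (second-neighbour kconn (ℕ.≤-trans (s≤s (s≤s z≤n)) 6≤k)))

-- The cycle space is spanned by face boundaries.

module _ {N} {G : Graph N} (E : SphericalEmbedding G) (conn : ConnectedOn G (V G)) where
  open SphericalEmbedding E
  open Embedding E
  open ChainOn

  -- The edge `ab` supplies a root vertex and a reference face. Genus 0 enters only through `euler`,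
  -- which makes the unknowns outnumber the equations.
  cycle-is-coboundary : ∀ {a b} → Adj G a b → ∀ {C} → ChainOn G C → (∀ x → ∂ C x ≡ false) →
    ∃[ c ] (∀ {x y} → Adj G x y → c (face x y) xor c (face y x) ≡ C x y)
  cycle-is-coboundary {r} {r′} rr′ {C} C-on ∂C = c , λ {x} {y} xy → xor-eq-false _ _ (begin
      (c (face x y) xor c (face y x)) xor C x y
        ≡⟨ cong (λ z → (z ∧ (c (face x y) xor c (face y x))) xor C x y) xy ⟨
      δ c x y xor C x y
        ≡⟨ cong (λ t → δ c x y xor (t ∧ C x y)) t≡1 ⟨
      δ c x y xor (t ∧ C x y)
        ≡⟨ δ+tC≡0 x y ⟩
      false ∎)
    where
    open ≡-Reasoning
    n = ∣ V G ∣
    v = elementAt (V G)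

    path : ∀ i → WalkIn G (V G) r (v i)
    path i = conn r (v i) (inV G r r′ rr′) (elementAt-∈ (V G) i)

    P : (Fin n → Bool) → Chain N
    P s = combination s (walkChain ∘ path)

    -- The walk to `v j` has boundary `r + v j`, so away from the root the boundary of the sum reads
    -- off the bit of each vertex.
    ∂P : ∀ s i → v i ≢ r → ∂ (P s) (v i) ≡ s i
    ∂P s i vᵢ≢r = begin
      ∂ (P s) (v i)
        ≡⟨ ∂-combination s (walkChain ∘ path) (v i) ⟩
      ⨁ (λ j → s j ∧ ∂ (walkChain (path j)) (v i))
        ≡⟨ sum-cong-≗ (λ j → cong (s j ∧_) (indicator j)) ⟩
      ⨁ (λ j → s j ∧ does (j ≟ i))
        ≡⟨ ⨁-select s i ⟩
      s i ∎
      where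
      indicator : ∀ j → ∂ (walkChain (path j)) (v i) ≡ does (j ≟ i)
      indicator j = begin
        ∂ (walkChain (path j)) (v i)            ≡⟨ ∂-walkChain (path j) (v i) ⟩
        does (v i ≟ r) xor does (v i ≟ v j)     ≡⟨ cong (_xor does (v i ≟ v j)) (dec-false (v i ≟ r) vᵢ≢r) ⟩
        does (v i ≟ v j)                        ≡⟨ ≟-injective v (elementAt-injective (V G)) i j ⟩
        does (i ≟ j)                            ≡⟨ ≟-sym i j ⟩
        does (j ≟ i)                            ∎

    -- A vector of unknowns is cut into one bit per vertex, one bit per face and a single scalar.
    S : (Fin (n + (F + 1)) → Bool) → Fin n → Bool
    S x i = x (i ↑ˡ (F + 1))

    K : (Fin (n + (F + 1)) → Bool) → Fin F → Bool
    K x f = x (n ↑ʳ (f ↑ˡ 1))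

    T : (Fin (n + (F + 1)) → Bool) → Bool
    T x = x (n ↑ʳ (F ↑ʳ zero))

    tC : Bool → Chain N
    tC t a b = t ∧ C a b

    D : (Fin (n + (F + 1)) → Bool) → Chain N
    D x = P (S x) ⊕ (δ (K x) ⊕ tC (T x))

    root = elementAt-surjective (V G) (inV G r r′ rr′)
    f₀ = face r r′

    -- Besides one equation per edge there are two normalisations. A walk from `r` to itself has no
    -- boundary, so its bit is set to 0 separately; fixing the colour of `f₀` excludes the nonzero
    -- constant colouring.
    Φ : (Fin (n + (F + 1)) → Bool) → Fin (2 + numEdges G) → Bool
    Φ x zero = S x (proj₁ root)
    Φ x (suc zero) = K x f₀
    Φ x (suc (suc e)) = D x (proj₁ (edgeAt G e)) (proj₂ (edgeAt G e))

    Φ-additive : ∀ x y j → Φ (λ i → x i xor y i) j ≡ Φ x j xor Φ y j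
    Φ-additive x y zero = refl
    Φ-additive x y (suc zero) = refl
    Φ-additive x y (suc (suc e)) = begin
      P (S xy) a b xor (δ (K xy) a b xor tC (T xy) a b)
        ≡⟨ cong₂ _xor_ P-additive (cong₂ _xor_ δ-additive (∧-distribʳ-xor (C a b) (T x) (T y))) ⟩
      (Pˣ xor Pʸ) xor ((δˣ xor δʸ) xor (Cˣ xor Cʸ))
        ≡⟨ cong ((Pˣ xor Pʸ) xor_) (xor-interchange δˣ δʸ Cˣ Cʸ) ⟩
      (Pˣ xor Pʸ) xor ((δˣ xor Cˣ) xor (δʸ xor Cʸ))
        ≡⟨ xor-interchange Pˣ Pʸ (δˣ xor Cˣ) (δʸ xor Cʸ) ⟩
      D x a b xor D y a b ∎
      where
      a = proj₁ (edgeAt G e)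
      b = proj₂ (edgeAt G e)
      xy : Fin (n + (F + 1)) → Bool
      xy i = x i xor y i
      Pˣ = P (S x) a b
      Pʸ = P (S y) a b
      δˣ = δ (K x) a b
      δʸ = δ (K y) a b
      Cˣ = tC (T x) a b
      Cʸ = tC (T y) a b
      P-additive : P (S xy) a b ≡ Pˣ xor Pʸ
      P-additive = trans
        (sum-cong-≗ (λ i → ∧-distribʳ-xor (walkChain (path i) a b) (S x i) (S y i)))
        (∑-distrib-+ (λ i → S x i ∧ walkChain (path i) a b) (λ i → S y i ∧ walkChain (path i) a b))
      δ-additive : δ (K xy) a b ≡ δˣ xor δʸ
      δ-additive = trans
        (cong (adj G a b ∧_) (xor-interchange (K x (face a b)) (K y (face a b)) (K x (face b a)) (K y (face b a))))
        (∧-distribˡ-xor (adj G a b) _ _)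

    -- By Euler's formula there is exactly one unknown more than there are equations.
    fewer : 2 + numEdges G < n + (F + 1)
    fewer = ℕ.≤-reflexive (begin
      suc (2 + numEdges G) ≡⟨ cong suc euler ⟨
      suc (n + F)          ≡⟨ ℕ.+-comm 1 (n + F) ⟩
      n + F + 1            ≡⟨ ℕ.+-assoc n F 1 ⟩
      n + (F + 1)          ∎)

    solution = kernel-nontrivial fewer Φ Φ-additive
    x = proj₁ solution
    s = S x
    c = K x
    t = T x

    tC-on : ChainOn G (tC t)
    tC-on .symmetric a b = cong (t ∧_) (symmetric C-on a b)
    tC-on .supported a b ab = trans (cong (t ∧_) (supported C-on a b ab)) (∧-zeroʳ t)

    D-on : ChainOn G (D x)
    D-on = ⊕-chainOn (combination-chainOn s (walkChain-chainOn ∘ path)) (⊕-chainOn (δ-chainOn c) tC-on)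

    D≡0-on-edges : ∀ {a b} → Adj G a b → a Fin.< b → D x a b ≡ false
    D≡0-on-edges ab a<b with e , eq ← edgeAt-surjective G ab a<b =
      trans (cong (λ (a , b) → D x a b) (≡.sym eq)) (proj₂ (proj₂ solution) (suc (suc e)))

    -- The equations test one orientation of each edge; symmetry and support extend the vanishing to
    -- all pairs.
    D≡0 : ∀ a b → D x a b ≡ false
    D≡0 a b = split (adj G a b) refl
      where
      split : ∀ z → adj G a b ≡ z → D x a b ≡ false
      split false ab = supported D-on a b ab
      split true ab with Fin.<-cmp a b
      ... | tri< a<b _ _ = D≡0-on-edges ab a<b
      ... | tri≈ _ a≡b _ = contradiction a≡b (Adj⇒≢ G ab)
      ... | tri> _ _ b<a = trans (symmetric D-on a b) (D≡0-on-edges (Defs.sym G a b ab) b<a)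

    ∂D : ∀ a → ∂ (D x) a ≡ ∂ (P s) a
    ∂D a = begin
      ∂ (D x) a
        ≡⟨ ∑-distrib-+ (P s a) ((δ c ⊕ tC t) a) ⟩
      ∂ (P s) a xor ∂ (δ c ⊕ tC t) a
        ≡⟨ cong (∂ (P s) a xor_) (∑-distrib-+ (δ c a) (tC t a)) ⟩
      ∂ (P s) a xor (∂ (δ c) a xor ∂ (tC t) a)
        ≡⟨ cong (∂ (P s) a xor_) (cong₂ _xor_ (∂-δ c a) (trans (⨁-∧ t (C a)) (trans (cong (t ∧_) (∂C a)) (∧-zeroʳ t)))) ⟩
      ∂ (P s) a xor false
        ≡⟨ xor-identityʳ _ ⟩
      ∂ (P s) a ∎

    -- Since `D x` vanishes, so does its boundary; `δ c` and `C` contribute nothing to it, which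
    -- leaves the bits of the walks.
    s≡0 : ∀ i → s i ≡ false
    s≡0 i with v i ≟ r
    ... | yes vᵢ≡r = trans
      (cong s (elementAt-injective (V G) (trans vᵢ≡r (≡.sym (proj₂ root)))))
      (proj₂ (proj₂ solution) zero)
    ... | no vᵢ≢r = begin
      s i            ≡⟨ ∂P s i vᵢ≢r ⟨
      ∂ (P s) (v i)  ≡⟨ ∂D (v i) ⟨
      ∂ (D x) (v i)  ≡⟨ ⨁-zero (D x (v i)) (D≡0 (v i)) ⟩
      false          ∎

    δ+tC≡0 : ∀ a b → δ c a b xor (t ∧ C a b) ≡ false
    δ+tC≡0 a b = trans
      (cong (_xor (δ c a b xor (t ∧ C a b)))
        (≡.sym (⨁-zero (λ i → s i ∧ walkChain (path i) a b) (λ i → cong (_∧ walkChain (path i) a b) (s≡0 i)))))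
      (D≡0 a b)

    -- If t vanished, δ c would vanish, so c would be constant with value c f₀ = 0.
    t≡1 : t ≡ true
    t≡1 with t in t≡
    ... | true = refl
    ... | false = contradiction x≡0 (proj₁ (proj₂ solution))
      where
      uncut : ∀ a → Uncut c a
      uncut a b ab = xor-eq-false _ _ (begin
        c (face a b) xor c (face b a) ≡⟨ cong (_∧ (c (face a b) xor c (face b a))) ab ⟨
        δ c a b                       ≡⟨ xor-identityʳ _ ⟨
        δ c a b xor (false ∧ C a b)   ≡⟨ cong (λ t → δ c a b xor (t ∧ C a b)) t≡ ⟨
        δ c a b xor (t ∧ C a b)       ≡⟨ δ+tC≡0 a b ⟩
        false ∎)

      c≡0 : ∀ f → c f ≡ false
      c≡0 f = trans (uncut-constant c conn uncut f f₀) (proj₂ (proj₂ solution) (suc zero))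

      x≡0 : ∀ i → x i ≡ false
      x≡0 i = trans (cong x (≡.sym (join-splitAt n (F + 1) i))) (outer (splitAt n i))
        where
        inner : ∀ k → x (n ↑ʳ join F 1 k) ≡ false
        inner (inj₁ f) = c≡0 f
        inner (inj₂ zero) = t≡
        outer : ∀ k → x (join n (F + 1) k) ≡ false
        outer (inj₁ i) = s≡0 i
        outer (inj₂ k) = trans (cong (x ∘ (n ↑ʳ_)) (≡.sym (join-splitAt F 1 k))) (inner (splitAt F k))

-- Rotation around a vertex and separating 4-cycles

iter-+ : ∀ {A : Set} (f : A → A) m n x → iter f (m + n) x ≡ iter f m (iter f n x)
iter-+ f zero n x = refl
iter-+ f (suc m) n x = cong f (iter-+ f m n x)

constant-on-segment : ∀ {A : Set} (R : ℕ → A) {m n} → m ≤ n → (∀ i → m ≤ i → i < n → R (suc i) ≡ R i) → R n ≡ R m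
constant-on-segment R {m} m≤n = go (ℕ.≤⇒≤′ m≤n)
  where
  go : ∀ {n} → m ℕ.≤′ n → (∀ i → m ≤ i → i < n → R (suc i) ≡ R i) → R n ≡ R m
  go (ℕ.≤′-reflexive refl) _ = refl
  go {suc n} (ℕ.≤′-step m≤n) stays = trans (stays n (ℕ.≤′⇒≤ m≤n) ℕ.≤-refl)
    (go m≤n (λ i m≤i i<n → stays i m≤i (ℕ.m<n⇒m<1+n i<n)))

module Rotation {N} {G : Graph N} (E : SphericalEmbedding G) {u p : Fin N} (up : Adj G u p) where
  open SphericalEmbedding E
  open Embedding E

  turn : ℕ → Fin N
  turn i = iter (ρ u) i p

  turn-adj : ∀ i → Adj G u (turn i)
  turn-adj i = iter-adj i up

  iter-injective : ∀ i {a b} → Adj G u a → Adj G u b → iter (ρ u) i a ≡ iter (ρ u) i b → a ≡ b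
  iter-injective zero _ _ eq = eq
  iter-injective (suc i) ua ub eq = iter-injective i ua ub
    (ρ-inj u _ _ (iter-adj i ua) (iter-adj i ub) eq)

  -- Cancelling `i` rotations turns a repetition into a return to the start `p`.
  turn-cancel : ∀ {i j} → i ≤ j → turn i ≡ turn j → turn (j ℕ.∸ i) ≡ p
  turn-cancel {i} {j} i≤j eq = ≡.sym (iter-injective i up (turn-adj (j ℕ.∸ i)) (begin
    turn i                       ≡⟨ eq ⟩
    turn j                       ≡⟨ cong turn (ℕ.m+[n∸m]≡n i≤j) ⟨
    turn (i + (j ℕ.∸ i))         ≡⟨ iter-+ (ρ u) i (j ℕ.∸ i) p ⟩
    iter (ρ u) i (turn (j ℕ.∸ i)) ∎))
    where open ≡-Reasoning

  -- An arrival at `w` within the first revolution from `p`; such times order the neighbours of `u`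
  -- other than `p`. Time 0 is exempt because `turn 0` is `p`.
  record Hit (w : Fin N) : Set where
    constructor hit
    field
      time    : ℕ
      arrives : turn time ≡ w
      fresh   : ∀ i → 0 < i → i < time → turn i ≢ p
  open Hit public

  -- `ρ-cyc` gives some arrival. As long as the rotation returns to `p` before it, the time of that
  -- return is subtracted.
  firstHit : ∀ {w} → Adj G u w → Hit w
  firstHit {w} uw = let j , eq = ρ-cyc u p w up uw in go j (<-wellFounded j) eq
    where
    go : ∀ j → Acc _<_ j → turn j ≡ w → Hit w
    go j (acc rec) eq with ℕ.anyUpTo? (λ i → (0 ℕ.<? i) ×-dec (turn i ≟ p)) j
    ... | no ∄return = hit j eq (λ i 0<i i<j return → ∄return (i , i<j , 0<i , return))
    ... | yes (i , i<j , 0<i , return) = go (j ℕ.∸ i) (rec (ℕ.∸-monoʳ-< 0<i (ℕ.<⇒≤ i<j))) (begin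
      turn (j ℕ.∸ i)                ≡⟨ cong (iter (ρ u) (j ℕ.∸ i)) return ⟨
      iter (ρ u) (j ℕ.∸ i) (turn i) ≡⟨ iter-+ (ρ u) (j ℕ.∸ i) i p ⟨
      turn (j ℕ.∸ i + i)            ≡⟨ cong turn (ℕ.m∸n+n≡m (ℕ.<⇒≤ i<j)) ⟩
      turn j                        ≡⟨ eq ⟩
      w                             ∎)
      where open ≡-Reasoning

  no-repeat : ∀ {w} (h : Hit w) {i j} → i < j → j < time h → turn i ≢ turn j
  no-repeat h {i} {j} i<j j<t eq = fresh h (j ℕ.∸ i) (ℕ.m<n⇒0<n∸m i<j)
    (ℕ.≤-<-trans (ℕ.m∸n≤m j i) j<t) (turn-cancel (ℕ.<⇒≤ i<j) eq)

  time-injective : ∀ {w w′} (h : Hit w) (h′ : Hit w′) → time h ≡ time h′ → w ≡ w′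
  time-injective h h′ eq = trans (≡.sym (arrives h)) (trans (cong turn eq) (arrives h′))

  hit-positive : ∀ {w} (h : Hit w) → p ≢ w → 0 < time h
  hit-positive (hit zero eq _) p≢w = contradiction eq p≢w
  hit-positive (hit (suc _) _ _) _ = s≤s z≤n

edge-swapped : ∀ {N} {u w : Fin N} → u ≢ w → edge w u u w ≡ true
edge-swapped {u = u} {w} u≢w
  rewrite dec-false (u ≟ w) u≢w | dec-true (u ≟ u) refl | dec-true (w ≟ w) refl = refl

module _ {N} {G : Graph N} (kconn : KConnected 5 G) (conn : ConnectedOn G (V G)) (E : SphericalEmbedding G)
  {u v p} (u≢v : u ≢ v) (up : Adj G u p) (vp : Adj G v p) where
  open SphericalEmbedding E
  open Embedding E
  open Rotation E up

  -- With this order, b and e would lie on different sides of the 4-cycle u p v d at u.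
  separating-4-cycle : ∀ {b d e} → Adj G u b → Adj G u d → Adj G v d → Adj G u e →
    p ≢ b → p ≢ d → p ≢ e → d ≢ b → d ≢ e → b ≢ v → e ≢ v →
    (hb : Hit b) (hd : Hit d) (he : Hit e) → ¬ (time hb < time hd × time hd < time he)
  separating-4-cycle {b} {d} {e} ub ud vd ue p≢b p≢d p≢e d≢b d≢e b≢v e≢v hb hd he (b<d , d<e) =
    -- A walk outside the cycle gives equal colours at `b` and `e`, the rotation around `u` opposite
    -- ones.
    not-¬ {R (time hb)} refl (trans (trans (trans (≡.sym colour-b) same-side) colour-e) R-e)
    where
    u∈V = inV G u p up
    v∈V = inV G v p vp
    pv = Defs.sym G v p vp
    du = Defs.sym G u d ud

    cycle : WalkIn G (V G) u u
    cycle = step u∈V up (step (inVʳ G up) pv (step v∈V vd (step (inVʳ G ud) du (stop u∈V))))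

    C = walkChain cycle

    C-off : ∀ x y → x ≢ u → x ≢ v → x ≢ p → x ≢ d → C x y ≡ false
    C-off x y x≢u x≢v x≢p x≢d
      rewrite edge-false u p x y (x≢u ∘ proj₁) (x≢p ∘ proj₁)
            | edge-false p v x y (x≢p ∘ proj₁) (x≢v ∘ proj₁)
            | edge-false v d x y (x≢v ∘ proj₁) (x≢d ∘ proj₁)
            | edge-false d u x y (x≢d ∘ proj₁) (x≢u ∘ proj₁) = refl

    u≢p = Adj⇒≢ G up
    u≢d = Adj⇒≢ G ud

    C-u-off : ∀ y → y ≢ p → y ≢ d → C u y ≡ false
    C-u-off y y≢p y≢d
      rewrite edge-false u p u y (y≢p ∘ proj₂) (u≢p ∘ proj₁)
            | edge-false p v u y (u≢p ∘ proj₁) (u≢v ∘ proj₁)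
            | edge-false v d u y (u≢v ∘ proj₁) (u≢d ∘ proj₁)
            | edge-false d u u y (u≢d ∘ proj₁) (y≢d ∘ proj₂) = refl

    C-u-d : C u d ≡ true
    C-u-d
      rewrite edge-false u p u d ((p≢d ∘ ≡.sym) ∘ proj₂) (u≢p ∘ proj₁)
            | edge-false p v u d (u≢p ∘ proj₁) (u≢v ∘ proj₁)
            | edge-false v d u d (u≢v ∘ proj₁) (u≢d ∘ proj₁)
            | edge-swapped u≢d = refl

    ∂C : ∀ x → ∂ C x ≡ false
    ∂C x = trans (∂-walkChain cycle x) (xor-same (does (x ≟ u)))

    colouring = cycle-is-coboundary E conn up (walkChain-chainOn cycle) ∂C
    c = proj₁ colouring

    -- The colours of the faces met in turn around `u`: the edge to `turn i` lies between `R i` and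
    -- `R (suc i)`.
    R : ℕ → Bool
    R i = c (face u (turn i))

    R-step : ∀ i → R i xor R (suc i) ≡ C u (turn i)
    R-step i = trans
      (cong (λ f → R i xor c f) (≡.sym (face-next (Defs.sym G u (turn i) (turn-adj i)))))
      (proj₂ colouring (turn-adj i))

    -- The only edges of `C` at `u` lead to `p` and `d`. Between time 0 and `time he` the rotation
    -- never meets `p`, and it meets `d` only at `time hd`.
    R-stays : ∀ i → 0 < i → i < time he → i ≢ time hd → R (suc i) ≡ R i
    R-stays i 0<i i<e i≢d = ≡.sym (xor-eq-false _ _ (trans (R-step i)
      (C-u-off (turn i) (fresh he i 0<i i<e) turn≢d)))
      where
      turn≢d : turn i ≢ d
      turn≢d eq with ℕ.<-cmp i (time hd)
      ... | tri< i<d _ _ = no-repeat he i<d d<e (trans eq (≡.sym (arrives hd)))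
      ... | tri≈ _ i≡d _ = i≢d i≡d
      ... | tri> _ _ d<i = no-repeat he d<i i<e (trans (arrives hd) (≡.sym eq))

    R-d : R (time hd) ≡ R (time hb)
    R-d = constant-on-segment R (ℕ.<⇒≤ b<d) (λ i b≤i i<d →
      R-stays i (ℕ.<-≤-trans (hit-positive hb p≢b) b≤i) (ℕ.<-trans i<d d<e) (ℕ.<⇒≢ i<d))

    -- The edge `ud` is the only edge of the cycle passed between `b` and `e`.
    R-flip : R (suc (time hd)) ≡ not (R (time hd))
    R-flip = xor-eq-true (R (time hd)) (R (suc (time hd)))
      (trans (R-step (time hd)) (trans (cong (C u) (arrives hd)) C-u-d))
      where
      xor-eq-true : ∀ a b → a xor b ≡ true → b ≡ not a
      xor-eq-true true false _ = refl
      xor-eq-true false true _ = refl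

    R-e : R (time he) ≡ not (R (time hb))
    R-e = trans (constant-on-segment R d<e (λ i d<i i<e →
      R-stays i (ℕ.≤-<-trans z≤n d<i) i<e (ℕ.<⇒≢ d<i ∘ ≡.sym))) (trans R-flip (cong not R-d))

    same-colour : ∀ {w} → Adj G u w → p ≢ w → d ≢ w → (h : Hit w) → c (face w u) ≡ R (time h)
    same-colour {w} uw p≢w d≢w h = trans
      (≡.sym (xor-eq-false _ _ (trans (proj₂ colouring uw) (C-u-off w (p≢w ∘ ≡.sym) (d≢w ∘ ≡.sym)))))
      (cong (c ∘ face u) (≡.sym (arrives h)))

    colour-b : c (face b u) ≡ R (time hb)
    colour-b = same-colour ub p≢b d≢b hb

    colour-e : c (face e u) ≡ R (time he)
    colour-e = same-colour ue p≢e d≢e he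

    xs = u ∷ v ∷ p ∷ d ∷ []
    X = fromList xs

    X-unique : Unique xs
    X-unique = (u≢v ∷ u≢p ∷ u≢d ∷ []) ∷ (Adj⇒≢ G vp ∷ Adj⇒≢ G vd ∷ []) ∷ (p≢d ∷ []) ∷ [] ∷ []

    ∉X : ∀ {w} → Adj G u w → w ≢ v → p ≢ w → d ≢ w → w ∉ X
    ∉X uw w≢v p≢w d≢w w∈X with ∈-fromList⁻ xs w∈X
    ... | here w≡u = Adj⇒≢ G uw (≡.sym w≡u)
    ... | there (here w≡v) = w≢v w≡v
    ... | there (there (here w≡p)) = p≢w (≡.sym w≡p)
    ... | there (there (there (here w≡d))) = d≢w (≡.sym w≡d)

    -- Every edge of `C` has both ends in `X`, so no edge at a remaining vertex changes the colour.
    uncut : ∀ {x} → x ∈ V G ─ X → Uncut c x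
    uncut {x} x∈ y xy = xor-eq-false _ _ (trans (proj₂ colouring xy) (C-off x y
      (λ x≡u → x∉X (∈-fromList⁺ {xs = xs} (here x≡u)))
      (λ x≡v → x∉X (∈-fromList⁺ {xs = xs} (there (here x≡v))))
      (λ x≡p → x∉X (∈-fromList⁺ {xs = xs} (there (there (here x≡p)))))
      (λ x≡d → x∉X (∈-fromList⁺ {xs = xs} (there (there (there (here x≡d))))))))
      where x∉X = x∈p─q⇒x∉q (V G) X x∈

    -- Only four vertices are deleted, so 5-connectivity leaves a walk from `b` to `e`, along which
    -- the colour is kept.
    same-side : c (face b u) ≡ c (face e u)
    same-side = uncut-walk c uncut
      (proj₂ kconn X (fromList-⊆ (u∈V ∷ v∈V ∷ inVʳ G up ∷ inVʳ G ud ∷ []))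
        (ℕ.≤-reflexive (cong suc (∣fromList∣ X-unique))) b e
        (x∈p∧x∉q⇒x∈p─q (inVʳ G ub) (∉X ub b≢v p≢b d≢b))
        (x∈p∧x∉q⇒x∈p─q (inVʳ G ue) (∉X ue e≢v p≢e d≢e)))
      (Defs.sym G u b ub) (Defs.sym G u e ue)

  -- Whichever of `x`, `y`, `z` comes second in the rotation from `p` forms with `u`, `p`, `v` the
  -- 4-cycle that separates the other two.
  no-4-common-neighbours : ∀ {x y z} → Unique (p ∷ x ∷ y ∷ z ∷ []) →
    All (λ w → Adj G u w × Adj G v w) (x ∷ y ∷ z ∷ []) → Empty.⊥
  no-4-common-neighbours {x} {y} {z} ((p≢x ∷ p≢y ∷ p≢z ∷ []) ∷ (x≢y ∷ x≢z ∷ []) ∷ (y≢z ∷ []) ∷ _)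
    (x~ ∷ y~ ∷ z~ ∷ []) = by-order (ℕ.<-cmp (time hx) (time hy)) (ℕ.<-cmp (time hy) (time hz)) (ℕ.<-cmp (time hx) (time hz))
    where
    hx = firstHit (proj₁ x~)
    hy = firstHit (proj₁ y~)
    hz = firstHit (proj₁ z~)

    Common : Fin N → Set
    Common w = (Adj G u w × Adj G v w) × p ≢ w

    unordered : ∀ {b d e} → Common b → Common d → Common e → b ≢ d → d ≢ e →
      (hb : Hit b) (hd : Hit d) (he : Hit e) → time hb < time hd → ¬ (time hd < time he)
    unordered ((ub , vb) , p≢b) ((ud , vd) , p≢d) ((ue , ve) , p≢e) b≢d d≢e hb hd he b<d d<e =
      separating-4-cycle ub ud vd ue p≢b p≢d p≢e (b≢d ∘ ≡.sym) d≢e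
        (Adj⇒≢ G vb ∘ ≡.sym) (Adj⇒≢ G ve ∘ ≡.sym) hb hd he (b<d , d<e)

    x! : Common x
    x! = x~ , p≢x
    y! : Common y
    y! = y~ , p≢y
    z! : Common z
    z! = z~ , p≢z

    by-order : Tri (time hx < time hy) (time hx ≡ time hy) (time hy < time hx) →
      Tri (time hy < time hz) (time hy ≡ time hz) (time hz < time hy) →
      Tri (time hx < time hz) (time hx ≡ time hz) (time hz < time hx) → Empty.⊥
    by-order (tri≈ _ x≡y _) _ _ = x≢y (time-injective hx hy x≡y)
    by-order _ (tri≈ _ y≡z _) _ = y≢z (time-injective hy hz y≡z)
    by-order _ _ (tri≈ _ x≡z _) = x≢z (time-injective hx hz x≡z)
    by-order (tri< x<y _ _) (tri< y<z _ _) _ = unordered x! y! z! x≢y y≢z hx hy hz x<y y<z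
    by-order (tri< x<y _ _) (tri> _ _ z<y) (tri< x<z _ _) = unordered x! z! y! x≢z (y≢z ∘ ≡.sym) hx hz hy x<z z<y
    by-order (tri< x<y _ _) (tri> _ _ z<y) (tri> _ _ z<x) = unordered z! x! y! (x≢z ∘ ≡.sym) x≢y hz hx hy z<x x<y
    by-order (tri> _ _ y<x) (tri< y<z _ _) (tri< x<z _ _) = unordered y! x! z! (x≢y ∘ ≡.sym) x≢z hy hx hz y<x x<z
    by-order (tri> _ _ y<x) (tri< y<z _ _) (tri> _ _ z<x) = unordered y! z! x! y≢z (x≢z ∘ ≡.sym) hy hz hx y<z z<x
    by-order (tri> _ _ y<x) (tri> _ _ z<y) _ = unordered z! y! x! (y≢z ∘ ≡.sym) (x≢y ∘ ≡.sym) hz hy hx z<y y<x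

-- Reconstruction from connected triples

first-step : ∀ {N} {G : Graph N} {S a b} → WalkIn G S a b → a ≢ b → ∃[ y ] y ∈ S × Adj G a y
first-step (stop _) a≢a = contradiction refl a≢a
first-step (step _ ay p) _ = _ , walk-start p , ay

star-connected : ∀ {N} (G : Graph N) {S u} → u ∈ S → (∀ {x} → x ∈ S → x ≢ u → Adj G u x) → ConnectedOn G S
star-connected G {S} {u} u∈S spoke x y x∈S y∈S with x ≟ u | y ≟ u
... | yes refl | yes refl = stop u∈S
... | yes refl | no y≢u = step u∈S (spoke y∈S y≢u) (stop y∈S)
... | no x≢u | yes refl = step x∈S (Defs.sym G u x (spoke x∈S x≢u)) (stop u∈S)
... | no x≢u | no y≢u = step x∈S (Defs.sym G u x (spoke x∈S x≢u)) (step u∈S (spoke y∈S y≢u) (stop y∈S))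

module _ {N} {G₁ G₂ : Graph N} (same : SameT3 G₁ G₂) where

  -- The path `v`, `u`, `w` makes the triple connected in `G₁`, hence also in `G₂`.
  cherry : ∀ {u v w} → Adj G₁ u v → Adj G₁ u w → v ≢ w → InT3 G₂ (fromList (u ∷ v ∷ w ∷ []))
  cherry {u} {v} {w} uv uw v≢w = Equivalence.to (same (fromList xs))
    ( ∣fromList∣ ((Adj⇒≢ G₁ uv ∷ Adj⇒≢ G₁ uw ∷ []) ∷ (v≢w ∷ []) ∷ [] ∷ [])
    , fromList-⊆ (inV G₁ u v uv ∷ inVʳ G₁ uv ∷ inVʳ G₁ uw ∷ [])
    , star-connected G₁ (∈-fromList⁺ {xs = xs} (here refl)) (λ x∈ → spoke (∈-fromList⁻ xs x∈)))
    where
    xs = u ∷ v ∷ w ∷ []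
    spoke : ∀ {x} → x ∈ˡ xs → x ≢ u → Adj G₁ u x
    spoke (here x≡u) x≢u = contradiction x≡u x≢u
    spoke (there (here refl)) _ = uv
    spoke (there (there (here refl))) _ = uw

  -- The triple is connected in `G₂` without the edge `uv`, so `u` and `v` can each have only `w` as
  -- a neighbour inside it.
  lost-edge : ∀ {u v w} → Adj G₁ u v → ¬ Adj G₂ u v → Adj G₁ u w → v ≢ w → Adj G₂ u w × Adj G₂ v w
  lost-edge {u} {v} {w} uv ¬uv uw v≢w = u~w (first-step (conn u v u∈S v∈S) (Adj⇒≢ G₁ uv)) ,
    v~w (first-step (conn v u v∈S u∈S) (Adj⇒≢ G₁ uv ∘ ≡.sym))
    where
    xs = u ∷ v ∷ w ∷ []
    S = fromList xs
    conn = proj₂ (proj₂ (cherry uv uw v≢w))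
    u∈S : u ∈ S
    u∈S = ∈-fromList⁺ {xs = xs} (here refl)
    v∈S : v ∈ S
    v∈S = ∈-fromList⁺ {xs = xs} (there (here refl))

    u~w : ∃[ y ] y ∈ S × Adj G₂ u y → Adj G₂ u w
    u~w (y , y∈S , uy) with ∈-fromList⁻ xs y∈S
    ... | here refl = contradiction refl (Adj⇒≢ G₂ uy)
    ... | there (here refl) = contradiction uy ¬uv
    ... | there (there (here refl)) = uy

    v~w : ∃[ y ] y ∈ S × Adj G₂ v y → Adj G₂ v w
    v~w (y , y∈S , vy) with ∈-fromList⁻ xs y∈S
    ... | here refl = contradiction (Defs.sym G₂ v u vy) ¬uv
    ... | there (here refl) = contradiction refl (Adj⇒≢ G₂ vy)
    ... | there (there (here refl)) = vy

  -- Two neighbours place every vertex in a connected triple, and triples of `G₂` consist of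
  -- vertices of `G₂`.
  V-⊆ : KConnected 5 G₁ → V G₁ ⊆ V G₂
  V-⊆ kconn {x} x∈V with f , f-inj , x~ ← neighbourAt kconn 2 x∈V (s≤s (s≤s z≤n)) =
    proj₁ (proj₂ (cherry (x~ zero) (x~ (suc zero)) f₀≢f₁)) (∈-fromList⁺ {xs = x ∷ f zero ∷ f (suc zero) ∷ []} (here refl))
    where
    f₀≢f₁ : f zero ≢ f (suc zero)
    f₀≢f₁ eq = contradiction (f-inj eq) λ ()

  Adj-⊆ : KConnected 5 G₁ → KConnPlanar 5 G₂ → ∀ {u v} → Adj G₁ u v → Adj G₂ u v
  Adj-⊆ kconn₁ (conn₂ , kconn₂ , planar₂) {u} {v} uv with adj G₂ u v in uv₂
  ... | true = refl
  ... | false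
    -- With `v` forbidden, the bound `4 + 1 ≤ 5` still allows four further neighbours of `u`.
    with neighbours kconn₁ (v ∷ []) (inV G₁ u v uv) (inVʳ G₁ uv ∷ []) ([] ∷ [])
      (λ { (here u≡v) → Adj⇒≢ G₁ uv u≡v }) 4 ℕ.≤-refl
  ... | (p ∷ x ∷ y ∷ z ∷ []) , refl , (up ∷ ux ∷ uy ∷ uz ∷ []) ,
      (p≢x ∷ p≢y ∷ p≢z ∷ p≢v ∷ []) ∷ (x≢y ∷ x≢z ∷ x≢v ∷ []) ∷ (y≢z ∷ y≢v ∷ []) ∷ (z≢v ∷ []) ∷ _ =
    Empty.⊥-elim (impossible planar₂)
    where
    common : ∀ {w} → Adj G₁ u w → w ≢ v → Adj G₂ u w × Adj G₂ v w
    common uw w≢v = lost-edge uv (λ uv → contradiction (trans (≡.sym uv) uv₂) λ ()) uw (w≢v ∘ ≡.sym)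

    impossible : ¬ Planar G₂
    impossible (inj₁ edgeless) = contradiction (trans (≡.sym (proj₁ (common up p≢v))) (edgeless u p)) λ ()
    impossible (inj₂ E) = no-4-common-neighbours kconn₂ (proj₂ conn₂) E (Adj⇒≢ G₁ uv)
      (proj₁ (common up p≢v)) (proj₂ (common up p≢v))
      ((p≢x ∷ p≢y ∷ p≢z ∷ []) ∷ (x≢y ∷ x≢z ∷ []) ∷ (y≢z ∷ []) ∷ [] ∷ [])
      (common ux x≢v ∷ common uy y≢v ∷ common uz z≢v ∷ [])

5-connected-planar-reconstructible : T3Reconstructible (KConnPlanar 5)
5-connected-planar-reconstructible N G₁ G₂ K₁@(_ , kconn₁ , _) K₂@(_ , kconn₂ , _) distinct same =
  distinct ( ⊆-antisym (V-⊆ same kconn₁) (V-⊆ same′ kconn₂)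
           , λ u v → both (Adj-⊆ same kconn₁ K₂ {u} {v}) (Adj-⊆ same′ kconn₂ K₁ {u} {v}))
  where
  same′ : SameT3 G₂ G₁
  same′ S = mk⇔ (Equivalence.from (same S)) (Equivalence.to (same S))

  both : ∀ {a b} → (a ≡ true → b ≡ true) → (b ≡ true → a ≡ true) → a ≡ b
  both {true} f g = ≡.sym (f refl)
  both {false} {true} f g = g refl
  both {false} {false} f g = refl

-- Two octahedra with the same connected triples

-- The axes of the octahedron are {0,3}, {1,4} and {2,5}; π relabels it.
module Octahedron (π : Fin 6 → Fin 6) where

  antipode : Fin 6 → Fin 6
  antipode v = (toℕ v + 3) mod 6

  -- The complete tripartite graph whose parts are the axes.
  adjacent : Fin 6 → Fin 6 → Bool
  adjacent u v = not (does (π u ≟ π v)) ∧ not (does (π u ≟ antipode (π v)))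

  -- Entry `u` of row `v` is the neighbour that follows `u` around `v`; the entries at `v` and at
  -- its antipode are fillers.
  rotation : Vec.Vec (Vec.Vec (Fin 6) 6) 6
  rotation = Vec.map (Vec.map (_mod 6))
    ( (0 ∷ 2 ∷ 4 ∷ 0 ∷ 5 ∷ 1 ∷ [])
    ∷ (5 ∷ 0 ∷ 0 ∷ 2 ∷ 0 ∷ 3 ∷ [])
    ∷ (1 ∷ 3 ∷ 0 ∷ 4 ∷ 0 ∷ 0 ∷ [])
    ∷ (0 ∷ 5 ∷ 1 ∷ 0 ∷ 2 ∷ 4 ∷ [])
    ∷ (2 ∷ 0 ∷ 3 ∷ 5 ∷ 0 ∷ 0 ∷ [])
    ∷ (4 ∷ 0 ∷ 0 ∷ 1 ∷ 3 ∷ 0 ∷ []) ∷ [])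

  -- The outer `π` has to undo the relabelling, which suits involutions such as `id` and `swap₃₄`.
  next : Fin 6 → Fin 6 → Fin 6
  next v u = π (Vec.lookup (Vec.lookup rotation (π v)) (π u))

  -- A face is an octant, encoded by the signs of its three corners.
  sign : Fin 6 → ℕ
  sign v = Vec.lookup (0 ∷ 0 ∷ 0 ∷ 1 ∷ 2 ∷ 4 ∷ []) (π v)

  octant : Fin 6 → Fin 6 → Fin 8
  octant u v = (sign u + sign v + sign (next v u)) mod 8

  _~_ : Fin 6 → Fin 6 → Set
  u ~ v = adjacent u v ≡ true

  _~?_ : ∀ u v → Dec (u ~ v)
  u ~? v = adjacent u v Bool.≟ true

  -- Degree 4 and triangular faces allow the exponents to range over `Fin 4` and `Fin 3`, so that
  -- exhaustive evaluation decides every condition.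
  record IsOctahedralMap : Set where
    field
      ~-sym        : ∀ u v → u ~ v → v ~ u
      ~-irrefl     : ∀ v → adjacent v v ≡ false
      next-adj     : ∀ v u → v ~ u → v ~ next v u
      next-inj     : ∀ v u w → v ~ u → v ~ w → next v u ≡ next v w → u ≡ w
      next-cyc     : ∀ v u w → v ~ u → v ~ w → ∃[ j ] iter (next v) (toℕ {4} j) u ≡ w
      octant-surj  : ∀ f → ∃[ u ] ∃[ v ] u ~ v × octant u v ≡ f
      octant-next  : ∀ u v → u ~ v → octant u v ≡ octant v (next v u)
      octant-orbit : ∀ u v u′ v′ → u ~ v → u′ ~ v′ → octant u v ≡ octant u′ v′ →
        ∃[ j ] iter (facePerm next) (toℕ {3} j) (u , v) ≡ (u′ , v′)
      joined       : ∀ u v w → u ≢ v → w ≢ u → w ≢ v → u ~ v ⊎ (u ~ w × w ~ v)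

  isOctahedralMap? : Dec IsOctahedralMap
  isOctahedralMap? = map′
    (λ (a , b , c , d , e , f , g , h , i) → record { ~-sym = a ; ~-irrefl = b ; next-adj = c ; next-inj = d
      ; next-cyc = e ; octant-surj = f ; octant-next = g ; octant-orbit = h ; joined = i })
    (λ m → let open IsOctahedralMap m in
      ~-sym , ~-irrefl , next-adj , next-inj , next-cyc , octant-surj , octant-next , octant-orbit , joined)
    ( (all? λ u → all? λ v → u ~? v →-dec v ~? u)
    ×-dec (all? λ v → adjacent v v Bool.≟ false)
    ×-dec (all? λ v → all? λ u → v ~? u →-dec v ~? next v u)
    ×-dec (all? λ v → all? λ u → all? λ w → v ~? u →-dec v ~? w →-dec next v u ≟ next v w →-dec u ≟ w)
    ×-dec (all? λ v → all? λ u → all? λ w → v ~? u →-dec v ~? w →-dec any? λ j → iter (next v) (toℕ {4} j) u ≟ w)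
    ×-dec (all? λ f → any? λ u → any? λ v → u ~? v ×-dec octant u v ≟ f)
    ×-dec (all? λ u → all? λ v → u ~? v →-dec octant u v ≟ octant v (next v u))
    ×-dec (all? λ u → all? λ v → all? λ u′ → all? λ v′ → u ~? v →-dec u′ ~? v′ →-dec
      octant u v ≟ octant u′ v′ →-dec
      any? λ j → ≡-dec _≟_ _≟_ (iter (facePerm next) (toℕ {3} j) (u , v)) (u′ , v′))
    ×-dec (all? λ u → all? λ v → all? λ w → ¬? (u ≟ v) →-dec ¬? (w ≟ u) →-dec ¬? (w ≟ v) →-dec
      (u ~? v ⊎-dec (u ~? w ×-dec w ~? v))))

  module _ (isMap : IsOctahedralMap) where
    open IsOctahedralMap isMap

    octahedron : Graph 6
    octahedron = record
      { V = ⊤ ; adj = adjacent ; sym = ~-sym ; loopless = ~-irrefl ; inV = λ _ _ _ → ∈⊤ }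

    -- Euler's formula stays a hypothesis here because it can be evaluated only once `π` is
    -- concrete.
    embedding : ∣ V octahedron ∣ + 8 ≡ 2 + numEdges octahedron → SphericalEmbedding octahedron
    embedding euler = record
      { ρ = next
      ; ρ-adj = next-adj
      ; ρ-inj = next-inj
      ; ρ-cyc = λ v u w vu vw → let j , eq = next-cyc v u w vu vw in toℕ j , eq
      ; F = 8
      ; face = octant
      ; face-surj = octant-surj
      ; face-orbit = λ u v u′ v′ uv u′v′ → mk⇔
          (λ same → let j , eq = octant-orbit u v u′ v′ uv u′v′ same in toℕ j , eq)
          (λ (j , eq) → trans (proj₂ (along j uv)) (cong (λ (x , y) → octant x y) eq))
      ; euler = euler
      }
      where
      -- Invariance under one face step extends to whole orbits, which gives the converse of
      -- `octant-orbit`.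
      along : ∀ {u v} j → u ~ v → let (x , y) = iter (facePerm next) j (u , v) in x ~ y × octant u v ≡ octant x y
      along zero uv = uv , refl
      along {u} {v} (suc j) uv =
        let x , y = iter (facePerm next) j (u , v)
            xy , eq = along j uv
        in next-adj y x (~-sym x y xy) , trans eq (octant-next x y xy)

    -- The size bound leaves a third vertex in `P` outside `X`, and by `joined` it links `u` and `v`
    -- if they are not adjacent. Taking `P` to be `⊤` gives 4-connectedness, and taking `X` to be
    -- `⊥` gives connected triples.
    connected-minus : ∀ P X → 2 + ∣ X ∣ < ∣ P ∣ → ConnectedOn octahedron (P ─ X)
    connected-minus P X small u v u∈ v∈ with u ≟ v
    ... | yes refl = stop u∈
    ... | no u≢v = via (⊈⇒witness P (⁅ u ⁆ ∪ (⁅ v ⁆ ∪ X)) (subst (_< ∣ P ∣) (≡.sym size) small))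
      where
      u∉ : u ∉ ⁅ v ⁆ ∪ X
      u∉ u∈′ with x∈p∪q⁻ ⁅ v ⁆ X u∈′
      ... | inj₁ u∈v = u≢v (x∈⁅y⁆⇒x≡y v u∈v)
      ... | inj₂ u∈X = x∈p─q⇒x∉q P X u∈ u∈X

      size : ∣ ⁅ u ⁆ ∪ (⁅ v ⁆ ∪ X) ∣ ≡ 2 + ∣ X ∣
      size = trans (∣⁅x⁆∪p∣ u _ u∉) (cong suc (∣⁅x⁆∪p∣ v X (x∈p─q⇒x∉q P X v∈)))

      via : ∃[ w ] w ∈ P × w ∉ ⁅ u ⁆ ∪ (⁅ v ⁆ ∪ X) → WalkIn octahedron (P ─ X) u v
      via (w , w∈P , w∉)
        with joined u v w u≢v
          (λ { refl → w∉ (x∈p∪q⁺ (inj₁ (x∈⁅x⁆ w))) })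
          (λ { refl → w∉ (x∈p∪q⁺ (inj₂ (x∈p∪q⁺ {p = ⁅ w ⁆} (inj₁ (x∈⁅x⁆ w))))) })
      ... | inj₁ uv = step u∈ uv (stop v∈)
      ... | inj₂ (uw , wv) = step u∈ uw (step w∈ wv (stop v∈))
        where
        w∈ : w ∈ P ─ X
        w∈ = x∈p∧x∉q⇒x∈p─q w∈P (λ w∈X → w∉ (x∈p∪q⁺ (inj₂ (x∈p∪q⁺ {p = ⁅ v ⁆} (inj₂ w∈X)))))

    connected-on : ∀ S → 2 < ∣ S ∣ → ConnectedOn octahedron S
    connected-on S large = subst (ConnectedOn octahedron) (p─⊥≡p S) (connected-minus S ⊥ large)

    k-connected-planar : ∣ V octahedron ∣ + 8 ≡ 2 + numEdges octahedron → ∀ {k} → k ≤ 4 → KConnPlanar k octahedron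
    k-connected-planar euler k≤4 =
      ((zero , ∈⊤) , connected-on ⊤ (s≤s (s≤s (s≤s z≤n)))) ,
      (ℕ.≤-<-trans k≤4 (s≤s (s≤s (s≤s (s≤s (s≤s z≤n))))) ,
        λ X _ X<k → connected-minus ⊤ X (ℕ.+-monoʳ-< 2 (ℕ.<-≤-trans X<k k≤4))) ,
      inj₂ (embedding euler)

    T3-all : ∀ {S} → ∣ S ∣ ≡ 3 → InT3 octahedron S
    T3-all {S} S≡3 = S≡3 , (λ _ → ∈⊤) , connected-on S (ℕ.≤-reflexive (≡.sym S≡3))

-- Under this relabelling the axes become {0,4}, {1,3} and {2,5}.
swap₃₄ : Fin 6 → Fin 6
swap₃₄ = Vec.lookup (# 0 ∷ # 1 ∷ # 2 ∷ # 4 ∷ # 3 ∷ # 5 ∷ [])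

abstract
  octahedral : Octahedron.IsOctahedralMap id
  octahedral = toWitness {a? = Octahedron.isOctahedralMap? id} _

  octahedral-swapped : Octahedron.IsOctahedralMap swap₃₄
  octahedral-swapped = toWitness {a? = Octahedron.isOctahedralMap? swap₃₄} _

-- The two octahedra have different pairs of antipodes, but in both every triple is connected.
4-connected-planar-ambiguous : ∀ k → k ≤ 4 → ¬ T3Reconstructible (KConnPlanar k)
4-connected-planar-ambiguous k k≤4 reconstructible = reconstructible 6 O₁ O₂
  (Octahedron.k-connected-planar id octahedral refl k≤4)
  (Octahedron.k-connected-planar swap₃₄ octahedral-swapped refl k≤4)
  -- The vertices 0 and 3 are antipodal in `O₁` but adjacent in `O₂`.
  (λ (_ , same) → contradiction (same (# 0) (# 3)) λ ())
  (λ S → mk⇔ (λ (S≡3 , _) → Octahedron.T3-all swap₃₄ octahedral-swapped S≡3)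
             (λ (S≡3 , _) → Octahedron.T3-all id octahedral S≡3))
  where
  O₁ = Octahedron.octahedron id octahedral
  O₂ = Octahedron.octahedron swap₃₄ octahedral-swapped

theorem3p5 : ((k : ℕ) → k ≤ 4 → ¬ T3Reconstructible (KConnPlanar k)) ×
    T3Reconstructible (KConnPlanar 5) ×
    ((k : ℕ) → 6 ≤ k → (N : ℕ) (G : Graph N) → ¬ KConnPlanar k G)
theorem3p5 = 4-connected-planar-ambiguous , 5-connected-planar-reconstructible ,
  λ k 6≤k N G → no-6-connected-planar G 6≤k
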